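{- For every integer $r\ge 1$, $\mathrm{evc}(G_r)\ge 3.5r+1$, where $G_r$ is the Halin graph defined in the context. Consequently, for every $\epsilon>0$ there exists $r\in\mathbb{N}$ such that $\frac{\mathrm{evc}(G_r)}{\mathrm{mvc}(G_r)}\ge \frac{7}{6}-\epsilon$, and $\rho(\mathcal{H})\ge\frac{7}{6}$, where $\mathcal{H}$ is the family of Halin graphs.
   Context: All graphs are finite, simple and undirected. A vertex cover of $G=(V,E)$ is a set $S\subseteq V$ meeting every edge; $\mathrm{mvc}(G)$ is the minimum size of a vertex cover. Eternal vertex cover: a configuration is a vertex cover $C\subseteq V$, viewed as the set of positions of guards (at most one guard per vertex). When an edge $uv$ is attacked, the defender reconfigures $C$ to a new configuration $C'$ by moving all guards simultaneously: every guard stays or moves to an adjacent vertex, and some guard on $u$ or $v$ must move along the edge $uv$ to its other endpoint. That is, there is a bijection $\varphi:C\to C'$ with $\varphi(w)=w$ or $\varphi(w)$ adjacent to $w$ for all $w\in C$, and such that $u\in C,\varphi(u)=v$ or $v\in C,\varphi(v)=u$. An eternal vertex cover class of $G$ is a nonempty set of configurations, all of the same cardinality (called the size of the class), such that for every configuration $C$ in the class and every edge $uv$, an attack on $uv$ can be answered by reconfiguring $C$ to some configuration in the class. The eternal vertex cover number $\mathrm{evc}(G)$ is the minimum size of an eternal vertex cover class. For an infinite family $\mathcal{F}$ of graphs, $\rho(\mathcal{F})=\sup\{s\in\mathbb{R} : \text{for infinitely many (pairwise non-isomorphic) graphs } G\in\mathcal{F},\ \frac{\mathrm{evc}(G)}{\mathrm{mvc}(G)}\ge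 s\}$. A Halin graph is obtained from a tree $T$ with no vertex of degree two (and at least three leaves), embedded in the plane, by connecting all leaves of $T$ to form a cycle in the cyclic order induced by the planar embedding. The graph $G_r$ ($r\ge1$) has the $6r+3$ vertices $x,y,z$ and $a_{i1},\dots,a_{i6}$ for $1\le i\le r$. Its edges are: $xy,xz,yz$; $za_{12}$ and $ya_{11}$; for each $1\le i\le r$ the edges $a_{i1}a_{i2}$, $a_{i2}a_{i3}$, $a_{i3}a_{i4}$, $a_{i3}a_{i5}$, $a_{i3}a_{i6}$, $a_{i1}a_{i4}$, $a_{i4}a_{i5}$, $a_{i5}a_{i6}$; for each $1\le i<r$ the edges $a_{i3}a_{(i+1)2}$ and $a_{i6}a_{(i+1)1}$; and $a_{r6}x$. -}

module Defs where

open import Level using (Level; 0ℓ; _⊔_) renaming (suc to lsuc)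
import Algebra.Properties.Group as GroupProperties
open import Data.Bool using (Bool; true; false; T)
open import Data.Bool.Properties using (T?)
open import Data.Empty using (⊥-elim)
open import Data.Fin using (Fin; zero; suc; inject₁; fromℕ; finToFun; funToFin)
open import Data.Fin.Patterns using (0F; 1F; 2F; 3F; 4F; 5F)
open import Data.Fin.Permutation.Components using (transpose)
import Data.Fin.Permutation.Components as PC
open import Data.Fin.Properties using (any?; all?; finToFun-funToFin; +↔⊎; *↔×)
import Data.Fin.Properties as Fin
open import Data.Fin.Subset using (Subset; _∈_; ∣_∣; ⊤; inside; outside)
open import Data.Fin.Subset.Properties using (_∈?_; anySubset?; ∈⊤; ∣⊤∣≡n)
import Data.Integer as ℤ
open import Data.List using (List; []; _∷_; _++_; concatMap; allFin)
open import Data.List.Membership.Propositional using () renaming (_∈_ to _∈ˡ_)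
import Data.List.Membership.DecPropositional as DecMembership
open import Data.List.Relation.Unary.All using (All; []; _∷_)
import Data.List.Relation.Unary.All as All
import Data.List.Relation.Unary.All.Properties as All
open import Data.Nat using (ℕ; zero; suc; _+_; _*_; _≤_; z≤n; s≤s; NonZero)
import Data.Nat.Properties as ℕ
open import Data.Nat.GeneralisedArithmetic using (iterate)
open import Data.Product using (Σ; Σ-syntax; ∃; ∃-syntax; _×_; _,_; proj₁; proj₂)
open import Data.Product.Properties using (≡-dec)
open import Data.Rational using (ℚ; 0ℚ) renaming (_<_ to _<ℚ_; _-_ to _-ℚ_; _/_ to _/ℚ_)
import Data.Rational as ℚ
import Data.Rational.Properties as ℚ
open import Data.Sum using (_⊎_; inj₁; inj₂; swap; [_,_]′)
import Data.Sum.Properties as Sum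
open import Data.Sum.Function.Propositional using (_⊎-↔_)
open import Data.Vec using (tabulate; []; _∷_)
open import Function using (_∘_; _⇔_; _↔_; Inverse; Equivalence; mk⇔)
open import Function.Construct.Composition using (_↔-∘_)
open import Function.Construct.Identity using (↔-id)
open import Function.Definitions using (Injective)
open import Relation.Binary using (Rel; Symmetric; Irreflexive; DecidableEquality)
import Relation.Binary as Binary
open import Relation.Binary.Construct.Closure.ReflexiveTransitive using (Star)
open import Relation.Binary.PropositionalEquality
open import Relation.Nullary using (¬_; Dec; yes; no; does)
open import Relation.Nullary.Decidable using (map′; ¬?; _×-dec_; _⊎-dec_; _→-dec_; ⌊_⌋; toWitness; fromWitness; decidable-stable; ¬¬-excluded-middle)
open import Relation.Unary using (Pred; Decidable)

private
  variable
    ℓ : Level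
    n m : ℕ

record Graph (n : ℕ) : Set₁ where
  field
    Adj    : Rel (Fin n) 0ℓ
    adj?   : Binary.Decidable Adj
    symm   : Symmetric Adj
    irrefl : Irreflexive _≡_ Adj

open Graph public using (Adj; adj?)

record _≅_ {n m} (Γ : Graph n) (Δ : Graph m) : Set where
  field
    vertices : Fin n ↔ Fin m
    edges    : ∀ u v → Adj Γ u v ⇔ Adj Δ (Inverse.to vertices u) (Inverse.to vertices v)

neighbours : Graph n → Fin n → Subset n
neighbours Γ v = tabulate λ w → does (adj? Γ v w)

degree : Graph n → Fin n → ℕ
degree Γ v = ∣ neighbours Γ v ∣

record IsMinimum (P : Pred ℕ ℓ) (k : ℕ) : Set ℓ where
  field
    holds : P k
    least : ∀ {j} → P j → k ≤ j

minimum : {P : Pred ℕ ℓ} → Decidable P → P n → ∃ (IsMinimum P)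
minimum {n = zero}      P? p = zero , record { holds = p ; least = λ _ → z≤n }
minimum {n = suc n} {P = P} P? p with P? zero
... | yes p₀ = zero , record { holds = p₀ ; least = λ _ → z≤n }
... | no ¬p₀ = suc k , record { holds = holds ; least = λ {j} → least′ {j} }
  where
  min = minimum {n = n} {P = P ∘ suc} (P? ∘ suc) p
  k   = proj₁ min
  open IsMinimum (proj₂ min)
  least′ : ∀ {j} → P j → suc k ≤ j
  least′ {zero}  q = ⊥-elim (¬p₀ q)
  least′ {suc j} q = s≤s (least q)

VertexCover : Graph n → Pred (Subset n) 0ℓ
VertexCover Γ S = ∀ u v → Adj Γ u v → u ∈ S ⊎ v ∈ S

HasVertexCover : Graph n → Pred ℕ 0ℓ
HasVertexCover Γ k = ∃[ S ] VertexCover Γ S × ∣ S ∣ ≡ k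

vertexCover? : (Γ : Graph n) → Decidable (VertexCover Γ)
vertexCover? Γ S = all? λ u → all? λ v → adj? Γ u v →-dec (u ∈? S ⊎-dec v ∈? S)

abstract
  mvc-exists : (Γ : Graph n) → ∃ (IsMinimum (HasVertexCover Γ))
  mvc-exists {n} Γ = minimum
    (λ k → anySubset? λ S → vertexCover? Γ S ×-dec ∣ S ∣ ℕ.≟ k)
    (⊤ , (λ _ _ _ → inj₁ ∈⊤) , ∣⊤∣≡n n)

mvc : Graph n → ℕ
mvc Γ = proj₁ (mvc-exists Γ)

-- Only the restriction of φ to C matters.
record IsDefence (Γ : Graph n) (u v : Fin n) (C C′ : Subset n) (φ : Fin n → Fin n) : Set where
  field
    into       : ∀ w → w ∈ C → φ w ∈ C′
    injective  : ∀ w w′ → w ∈ C → w′ ∈ C → φ w ≡ φ w′ → w ≡ w′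
    surjective : ∀ w′ → w′ ∈ C′ → ∃[ w ] w ∈ C × φ w ≡ w′
    step       : ∀ w → w ∈ C → φ w ≡ w ⊎ Adj Γ w (φ w)
    crosses    : (u ∈ C × φ u ≡ v) ⊎ (v ∈ C × φ v ≡ u)

Defends : Graph n → (u v : Fin n) → Rel (Subset n) 0ℓ
Defends Γ u v C C′ = ∃ (IsDefence Γ u v C C′)

record IsEternalClass (Γ : Graph n) (k : ℕ) (𝒞 : Pred (Subset n) 0ℓ) : Set where
  field
    nonempty : ∃ 𝒞
    cover    : ∀ C → 𝒞 C → VertexCover Γ C
    size     : ∀ C → 𝒞 C → ∣ C ∣ ≡ k
    defend   : ∀ C → 𝒞 C → ∀ u v → Adj Γ u v → ∃[ C′ ] 𝒞 C′ × Defends Γ u v C C′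

HasEternalClass : Graph n → Pred ℕ (lsuc 0ℓ)
HasEternalClass Γ k = ∃ (IsEternalClass Γ k)

-- HasEternalClass is decidable and attained, so that its minimum evc exists.

private
  anyFun? : {P : Pred (Fin m → Fin n) 0ℓ} →
            (∀ {f g} → f ≗ g → P f → P g) → Decidable P → Dec (∃ P)
  anyFun? resp P? = map′
    (λ (i , p) → finToFun i , p)
    (λ (f , p) → funToFin f , resp (λ x → sym (finToFun-funToFin f x)) p)
    (any? λ i → P? (finToFun i))

  allSubset? : {P : Pred (Subset n) 0ℓ} → Decidable P → Dec (∀ S → P S)
  allSubset? P? = map′
    (λ h S → decidable-stable (P? S) λ ¬p → h (S , ¬p))
    (λ h (S , ¬p) → ¬p (h S))
    (¬? (anySubset? (¬? ∘ P?)))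

  anyClass? : {P : Pred (Subset n → Bool) 0ℓ} →
              (∀ {f g} → f ≗ g → P f → P g) → Decidable P → Dec (∃ P)
  anyClass? {zero} {P} resp P? = map′
    [ (_ ,_) , (_ ,_) ]′ split (P? (λ _ → true) ⊎-dec P? (λ _ → false))
    where
    split : ∃ P → P (λ _ → true) ⊎ P (λ _ → false)
    split (f , p) with f [] in eq
    ... | true  = inj₁ (resp (λ { [] → eq }) p)
    ... | false = inj₂ (resp (λ { [] → eq }) p)
  anyClass? {suc n} {P} resp P? = map′
    (λ (f , g , p) → join f g , p)
    (λ (h , p) → h ∘ (inside ∷_) , h ∘ (outside ∷_) , resp (join-η h) p)
    (anyClass? (λ f≗f′ (g , p) → g , resp (join-cong f≗f′ λ _ → refl) p)
       λ f → anyClass? (λ g≗g′ → resp (join-cong (λ _ → refl) g≗g′)) (P? ∘ join f))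
    where
    join : (f g : Subset n → Bool) → Subset (suc n) → Bool
    join f g (true  ∷ S) = f S
    join f g (false ∷ S) = g S
    join-cong : ∀ {f f′ g g′} → f ≗ f′ → g ≗ g′ → join f g ≗ join f′ g′
    join-cong p q (true  ∷ S) = p S
    join-cong p q (false ∷ S) = q S
    join-η : ∀ h → h ≗ join (h ∘ (inside ∷_)) (h ∘ (outside ∷_))
    join-η h (true  ∷ S) = refl
    join-η h (false ∷ S) = refl

  ¬¬-decidable : (P : Pred (Subset n) 0ℓ) → ¬ ¬ Decidable P
  ¬¬-decidable {zero}  P k = ¬¬-excluded-middle λ d → k λ { [] → d }
  ¬¬-decidable {suc n} P k =
    ¬¬-decidable (P ∘ (inside ∷_)) λ d₁ → ¬¬-decidable (P ∘ (outside ∷_)) λ d₂ →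
    k λ { (true ∷ S) → d₁ S ; (false ∷ S) → d₂ S }

  isDefence-resp : ∀ {Γ : Graph n} {u v C C′ f g} → f ≗ g →
                   IsDefence Γ u v C C′ f → IsDefence Γ u v C C′ g
  isDefence-resp {Γ = Γ} {u} {v} {C} {C′} f≗g d = record
    { into       = λ w w∈C → subst (_∈ C′) (f≗g w) (into w w∈C)
    ; injective  = λ w w′ p q e → injective w w′ p q (trans (f≗g w) (trans e (sym (f≗g w′))))
    ; surjective = λ w′ p → let (w , q , e) = surjective w′ p in w , q , trans (sym (f≗g w)) e
    ; step       = λ w p → subst (λ x → x ≡ w ⊎ Adj Γ w x) (f≗g w) (step w p)
    ; crosses    = [ (λ (p , e) → inj₁ (p , trans (sym (f≗g u)) e))
                   , (λ (p , e) → inj₂ (p , trans (sym (f≗g v)) e)) ]′ crosses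
    }
    where
    open IsDefence d

  defends? : (Γ : Graph n) (u v : Fin n) → Binary.Decidable (Defends Γ u v)
  defends? Γ u v C C′ = anyFun? isDefence-resp λ φ → map′
    (λ (a , b , c , d , e) → record { into = a ; injective = b ; surjective = c ; step = d ; crosses = e })
    (λ d → let open IsDefence d in into , injective , surjective , step , crosses)
    (    (all? λ w → w ∈? C →-dec φ w ∈? C′)
    ×-dec (all? λ w → all? λ w′ → w ∈? C →-dec (w′ ∈? C →-dec (φ w Fin.≟ φ w′ →-dec w Fin.≟ w′)))
    ×-dec (all? λ w′ → w′ ∈? C′ →-dec any? λ w → w ∈? C ×-dec φ w Fin.≟ w′)
    ×-dec (all? λ w → w ∈? C →-dec (φ w Fin.≟ w ⊎-dec adj? Γ w (φ w)))
    ×-dec ((u ∈? C ×-dec φ u Fin.≟ v) ⊎-dec (v ∈? C ×-dec φ v Fin.≟ u)))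

  isEternalClass-resp : ∀ {Γ : Graph n} {k} {𝒞 𝒟 : Pred (Subset n) 0ℓ} →
                        (∀ C → 𝒞 C → 𝒟 C) → (∀ C → 𝒟 C → 𝒞 C) →
                        IsEternalClass Γ k 𝒞 → IsEternalClass Γ k 𝒟
  isEternalClass-resp to from c = record
    { nonempty = let (C , p) = nonempty in C , to C p
    ; cover    = λ C p → cover C (from C p)
    ; size     = λ C p → size C (from C p)
    ; defend   = λ C p u v e → let (C′ , q , d) = defend C (from C p) u v e in C′ , to C′ q , d
    }
    where open IsEternalClass c

  boolClass? : (Γ : Graph n) (k : ℕ) → Dec (∃[ f ] IsEternalClass Γ k (T ∘ f))
  boolClass? Γ k = anyClass?
    (λ f≗g → isEternalClass-resp (λ C → subst T (f≗g C)) (λ C → subst T (sym (f≗g C))))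
    λ f → map′
      (λ (a , b , c , d) → record { nonempty = a ; cover = b ; size = c ; defend = d })
      (λ c → let open IsEternalClass c in nonempty , cover , size , defend)
      (    anySubset? (T? ∘ f)
      ×-dec allSubset? (λ C → T? (f C) →-dec vertexCover? Γ C)
      ×-dec allSubset? (λ C → T? (f C) →-dec ∣ C ∣ ℕ.≟ k)
      ×-dec allSubset? (λ C → T? (f C) →-dec all? λ u → all? λ v → adj? Γ u v →-dec
              anySubset? λ C′ → T? (f C′) ×-dec defends? Γ u v C C′))

  hasEternalClass? : (Γ : Graph n) → Decidable (HasEternalClass Γ)
  hasEternalClass? Γ k = map′
    (λ (f , c) → T ∘ f , c)
    (λ (𝒞 , c) → decidable-stable (boolClass? Γ k) λ none →
      ¬¬-decidable 𝒞 λ 𝒞? → none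
        ((λ C → ⌊ 𝒞? C ⌋) , isEternalClass-resp (λ C → fromWitness) (λ C → toWitness) c))
    (boolClass? Γ k)

  transpose-cases : (u v w : Fin n) →
    (w ≡ u × transpose u v w ≡ v) ⊎ (w ≡ v × transpose u v w ≡ u) ⊎ transpose u v w ≡ w
  transpose-cases u v w with w Fin.≟ u
  ... | yes w≡u = inj₁ (w≡u , refl)
  ... | no  _ with w Fin.≟ v
  ...   | yes w≡v = inj₂ (inj₁ (w≡v , refl))
  ...   | no  _   = inj₂ (inj₂ refl)

  everyVertex : (Γ : Graph n) → IsEternalClass Γ n (_≡ ⊤)
  everyVertex {n} Γ = record
    { nonempty = ⊤ , refl
    ; cover    = λ { _ refl _ _ _ → inj₁ ∈⊤ }
    ; size     = λ { _ refl → ∣⊤∣≡n n }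
    ; defend   = λ { _ refl u v e → ⊤ , refl , transpose u v , defence u v e }
    }
    where
    defence : ∀ u v → Adj Γ u v → IsDefence Γ u v ⊤ ⊤ (transpose u v)
    defence u v e = record
      { into       = λ _ _ → ∈⊤
      ; injective  = λ w w′ _ _ eq → trans (sym (PC.transpose-inverse v u))
                       (trans (cong (transpose v u) eq) (PC.transpose-inverse v u))
      ; surjective = λ w′ _ → transpose v u w′ , ∈⊤ , PC.transpose-inverse u v
      ; step       = λ w _ → step w (transpose-cases u v w)
      ; crosses    = inj₁ (∈⊤ , u↦v)
      }
      where
      step : ∀ w → (w ≡ u × transpose u v w ≡ v) ⊎ (w ≡ v × transpose u v w ≡ u) ⊎ transpose u v w ≡ w →
             transpose u v w ≡ w ⊎ Adj Γ w (transpose u v w)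
      step w (inj₁ (refl , eq))        = inj₂ (subst (Adj Γ w) (sym eq) e)
      step w (inj₂ (inj₁ (refl , eq))) = inj₂ (subst (Adj Γ w) (sym eq) (Graph.symm Γ e))
      step w (inj₂ (inj₂ eq))          = inj₁ eq
      u↦v : transpose u v u ≡ v
      u↦v with u Fin.≟ u
      ... | yes _  = refl
      ... | no u≢u = ⊥-elim (u≢u refl)

abstract
  evc-exists : (Γ : Graph n) → ∃ (IsMinimum (HasEternalClass Γ))
  evc-exists Γ = minimum (hasEternalClass? Γ) (_ , everyVertex Γ)

evc : Graph n → ℕ
evc Γ = proj₁ (evc-exists Γ)

record ℝ : Set₁ where
  field
    L U       : Pred ℚ 0ℓ
    L-inhab   : ∃ L
    U-inhab   : ∃ U
    L-rounded : ∀ q → L q ⇔ (∃[ r ] q <ℚ r × L r)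
    U-rounded : ∀ q → U q ⇔ (∃[ r ] r <ℚ q × U r)
    disjoint  : ∀ q → ¬ (L q × U q)
    located   : ∀ q r → q <ℚ r → L q ⊎ U r

open ℝ public using (L; U)

_≤ᴿ_ : Rel ℝ 0ℓ
x ≤ᴿ y = ∀ q → L x q → L y q

Positive : Pred ℝ 0ℓ
Positive x = L x 0ℚ

private
  -‿anti : ∀ p {q r} → q <ℚ r → p -ℚ r <ℚ p -ℚ q
  -‿anti p q<r = ℚ.+-monoʳ-< p (ℚ.neg-antimono-< q<r)

  -‿invol : ∀ p q → p -ℚ (p -ℚ q) ≡ q
  -‿invol p q = begin
    p ℚ.+ ℚ.- (p ℚ.+ ℚ.- q)        ≡⟨ cong (p ℚ.+_) (ℚ.neg-distrib-+ p (ℚ.- q)) ⟩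
    p ℚ.+ (ℚ.- p ℚ.+ ℚ.- (ℚ.- q))  ≡⟨ ℚ.+-assoc p (ℚ.- p) _ ⟨
    (p ℚ.+ ℚ.- p) ℚ.+ ℚ.- (ℚ.- q)  ≡⟨ cong₂ ℚ._+_ (ℚ.+-inverseʳ p) (neg-invol q) ⟩
    0ℚ ℚ.+ q                       ≡⟨ ℚ.+-identityˡ q ⟩
    q                              ∎
    where
    open ≡-Reasoning
    open GroupProperties ℚ.+-0-group using () renaming (⁻¹-involutive to neg-invol)

fromℚ : ℚ → ℝ
fromℚ p = record
  { L         = _<ℚ p
  ; U         = p <ℚ_
  ; L-inhab   = p -ℚ ℚ.1ℚ , subst (p -ℚ ℚ.1ℚ <ℚ_) (ℚ.+-identityʳ p) (-‿anti p 0<1)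
  ; U-inhab   = p ℚ.+ ℚ.1ℚ , subst (_<ℚ p ℚ.+ ℚ.1ℚ) (ℚ.+-identityʳ p) (ℚ.+-monoʳ-< p 0<1)
  ; L-rounded = λ q → mk⇔ ℚ.<-dense (λ (r , q<r , r<p) → ℚ.<-trans q<r r<p)
  ; U-rounded = λ q → mk⇔ (λ p<q → let (r , p<r , r<q) = ℚ.<-dense p<q in r , r<q , p<r)
                          (λ (r , r<q , p<r) → ℚ.<-trans p<r r<q)
  ; disjoint  = λ q (q<p , p<q) → ℚ.<-asym q<p p<q
  ; located   = located
  }
  where
  0<1 : 0ℚ <ℚ ℚ.1ℚ
  0<1 = ℚ.positive⁻¹ ℚ.1ℚ
  located : ∀ q r → q <ℚ r → q <ℚ p ⊎ p <ℚ r
  located q r q<r with q ℚ.<? p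
  ... | yes q<p = inj₁ q<p
  ... | no  q≮p = inj₂ (ℚ.≤-<-trans (ℚ.≮⇒≥ q≮p) q<r)

infixl 6 _⊖_

_⊖_ : ℚ → ℝ → ℝ
p ⊖ x = record
  { L         = λ q → U x (p -ℚ q)
  ; U         = λ q → L x (p -ℚ q)
  ; L-inhab   = let (u , h) = U-inhab in p -ℚ u , subst (U x) (sym (-‿invol p u)) h
  ; U-inhab   = let (l , h) = L-inhab in p -ℚ l , subst (L x) (sym (-‿invol p l)) h
  ; L-rounded = λ q → mk⇔
      (λ h → let (r , r<p-q , Ur) = Equivalence.to (U-rounded (p -ℚ q)) h in
        p -ℚ r , subst (_<ℚ p -ℚ r) (-‿invol p q) (-‿anti p r<p-q)
               , subst (U x) (sym (-‿invol p r)) Ur)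
      (λ (r , q<r , h) → Equivalence.from (U-rounded (p -ℚ q)) (p -ℚ r , -‿anti p q<r , h))
  ; U-rounded = λ q → mk⇔
      (λ h → let (r , p-q<r , Lr) = Equivalence.to (L-rounded (p -ℚ q)) h in
        p -ℚ r , subst (p -ℚ r <ℚ_) (-‿invol p q) (-‿anti p p-q<r)
               , subst (L x) (sym (-‿invol p r)) Lr)
      (λ (r , r<q , h) → Equivalence.from (L-rounded (p -ℚ q)) (p -ℚ r , -‿anti p r<q , h))
  ; disjoint  = λ q (u , l) → disjoint (p -ℚ q) (l , u)
  ; located   = λ q r q<r → swap (located (p -ℚ r) (p -ℚ q) (-‿anti p q<r))
  }
  where
  open ℝ x hiding (L; U)

-- The lower cut of the supremum of S in the extended reals: the supremum of a
-- set of reals need not be located constructively.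
sup : Pred ℝ ℓ → Pred ℚ (lsuc 0ℓ ⊔ ℓ)
sup S q = ∃[ s ] S s × L s q

_≤ᶜ_ : ℚ → Pred ℚ ℓ → Set ℓ
p ≤ᶜ c = ∀ q → q <ℚ p → c q

Family : (ℓ : Level) → Set (lsuc 0ℓ ⊔ lsuc ℓ)
Family ℓ = ∀ {n} → Pred (Graph n) ℓ

ratio : (Γ : Graph n) .{{_ : NonZero (mvc Γ)}} → ℚ
ratio Γ = (ℤ.+ evc Γ) /ℚ mvc Γ

-- The ratio is undefined on edgeless graphs, which satisfy no such bound.
RatioAtLeast : ℝ → Family 0ℓ
RatioAtLeast s Γ = Σ[ nz ∈ NonZero (mvc Γ) ] s ≤ᴿ fromℚ (ratio Γ {{nz}})

InfinitelyMany : Family ℓ → Set (lsuc 0ℓ ⊔ ℓ)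
InfinitelyMany F = Σ[ g ∈ (ℕ → ∃ Graph) ]
  (∀ i j → i ≢ j → ¬ (proj₂ (g i) ≅ proj₂ (g j))) × (∀ i → F (proj₂ (g i)))

ρ : Family ℓ → Pred ℚ (lsuc 0ℓ ⊔ ℓ)
ρ F = sup λ s → InfinitelyMany λ Γ → F Γ × RatioAtLeast s Γ

record Cycle (Γ : Graph n) : Set where
  field
    {l}       : ℕ
    vertex    : Fin (3 + l) → Fin n
    injective : Injective _≡_ _≡_ vertex
    edges     : ∀ i → Adj Γ (vertex (inject₁ i)) (vertex (suc i))
    closing   : Adj Γ (vertex (fromℕ (2 + l))) (vertex zero)

record IsTree (Γ : Graph n) : Set where
  field
    connected : ∀ u v → Star (Adj Γ) u v
    acyclic   : ¬ Cycle Γ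

Leaf : (Γ : Graph n) → Pred (Fin n) 0ℓ
Leaf Γ v = degree Γ v ≡ 1

leaves : Graph n → Subset n
leaves Γ = tabulate λ v → does (degree Γ v ℕ.≟ 1)

-- A plane embedding of a tree, up to isotopy, amounts to a rotation system (for
-- a tree, every rotation system is planar): rotate v runs cyclically through
-- the neighbours of v, in a single orbit.
record PlaneEmbedding (Γ : Graph n) : Set where
  field
    rotate    : Fin n → Fin n → Fin n
    adjacent  : ∀ v w → Adj Γ v w → Adj Γ v (rotate v w)
    oneOrbit  : ∀ v w w′ → Adj Γ v w → Adj Γ v w′ → ∃[ k ] iterate (rotate v) w k ≡ w′

module _ {Γ : Graph n} (π : PlaneEmbedding Γ) where
  open PlaneEmbedding π

  -- ReachesLeaf u v ℓ: walking along the boundary of the face of the embedded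
  -- tree, starting with the step from u to v, the first leaf met is ℓ.
  data ReachesLeaf : (u v ℓ : Fin n) → Set where
    arrive : ∀ {u v} → Leaf Γ v → ReachesLeaf u v v
    turn   : ∀ {u v ℓ} → ¬ Leaf Γ v → ReachesLeaf v (rotate v u) ℓ → ReachesLeaf u v ℓ

  -- ℓ′ follows ℓ in the cyclic order of the leaves.
  NextLeaf : Rel (Fin n) 0ℓ
  NextLeaf ℓ ℓ′ = Leaf Γ ℓ × ∃[ p ] Adj Γ ℓ p × ReachesLeaf ℓ p ℓ′

record IsHalin {n} (Γ : Graph n) : Set₁ where
  field
    tree       : Graph n
    isTree     : IsTree tree
    noDegree2  : ∀ v → degree tree v ≢ 2
    leaves≥3   : 3 ≤ ∣ leaves tree ∣
    embedding  : PlaneEmbedding tree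
    adjacency  : ∀ u v → Adj Γ u v ⇔ (Adj tree u v ⊎ NextLeaf embedding u v ⊎ NextLeaf embedding v u)

Vertex : ℕ → Set
Vertex r = Fin 3 ⊎ (Fin r × Fin 6)

-- a₁ i, …, a₆ i are indexed by i from 0 to r - 1 rather than from 1 to r.
pattern xᵥ   = inj₁ 0F
pattern yᵥ   = inj₁ 1F
pattern zᵥ   = inj₁ 2F
pattern a₁ i = inj₂ (i , 0F)
pattern a₂ i = inj₂ (i , 1F)
pattern a₃ i = inj₂ (i , 2F)
pattern a₄ i = inj₂ (i , 3F)
pattern a₅ i = inj₂ (i , 4F)
pattern a₆ i = inj₂ (i , 5F)

_≟ⱽ_ : ∀ {r} → DecidableEquality (Vertex r)
_≟ⱽ_ = Sum.≡-dec Fin._≟_ (≡-dec Fin._≟_ Fin._≟_)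

vertex↔ : ∀ r → Fin (3 + r * 6) ↔ Vertex r
vertex↔ r = (↔-id (Fin 3) ⊎-↔ *↔×) ↔-∘ +↔⊎

outerEdges : ∀ k → List (Vertex (suc k) × Vertex (suc k))
outerEdges k = (xᵥ , yᵥ) ∷ (xᵥ , zᵥ) ∷ (yᵥ , zᵥ) ∷ (zᵥ , a₂ zero) ∷ (yᵥ , a₁ zero) ∷ (a₆ (fromℕ k) , xᵥ) ∷ []

gadgetEdges : ∀ {r} → Fin r → List (Vertex r × Vertex r)
gadgetEdges i =
  (a₁ i , a₂ i) ∷ (a₂ i , a₃ i) ∷ (a₃ i , a₄ i) ∷ (a₃ i , a₅ i) ∷
  (a₃ i , a₆ i) ∷ (a₁ i , a₄ i) ∷ (a₄ i , a₅ i) ∷ (a₅ i , a₆ i) ∷ []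

linkEdges : ∀ {k} → Fin k → List (Vertex (suc k) × Vertex (suc k))
linkEdges i = (a₃ (inject₁ i) , a₂ (suc i)) ∷ (a₆ (inject₁ i) , a₁ (suc i)) ∷ []

edgeList : ∀ k → List (Vertex (suc k) × Vertex (suc k))
edgeList k = outerEdges k ++ concatMap gadgetEdges (allFin (suc k)) ++ concatMap linkEdges (allFin k)

private
  Proper : ∀ {r} → Pred (Vertex r × Vertex r) 0ℓ
  Proper (u , v) = u ≢ v

  edges-proper : ∀ k → All Proper (edgeList k)
  edges-proper k = All.++⁺ outer (All.++⁺ (concatMap⁺ gadget (allFin (suc k))) (concatMap⁺ link (allFin k)))
    where
    outer : All Proper (outerEdges k)
    outer = (λ ()) ∷ (λ ()) ∷ (λ ()) ∷ (λ ()) ∷ (λ ()) ∷ (λ ()) ∷ []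
    gadget : ∀ (i : Fin (suc k)) → All Proper (gadgetEdges i)
    gadget i = (λ ()) ∷ (λ ()) ∷ (λ ()) ∷ (λ ()) ∷ (λ ()) ∷ (λ ()) ∷ (λ ()) ∷ (λ ()) ∷ []
    link : ∀ (i : Fin k) → All Proper (linkEdges i)
    link i = (λ ()) ∷ (λ ()) ∷ []
    concatMap⁺ : ∀ {A B : Set} {P : Pred B 0ℓ} {f : A → List B} →
                 (∀ a → All P (f a)) → ∀ as → All P (concatMap f as)
    concatMap⁺ h []       = []
    concatMap⁺ h (a ∷ as) = All.++⁺ (h a) (concatMap⁺ h as)

G : (r : ℕ) .{{_ : NonZero r}} → Graph (3 + r * 6)
G r@(suc k) = record
  { Adj    = λ u v → E (label u) (label v)
  ; adj?   = λ u v → ((label u , label v) ∈ˡ? edgeList k) ⊎-dec ((label v , label u) ∈ˡ? edgeList k)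
  ; symm   = swap
  ; irrefl = λ { refl → [ loopless , loopless ]′ }
  }
  where
  open DecMembership (≡-dec (_≟ⱽ_ {r}) (_≟ⱽ_ {r})) using () renaming (_∈?_ to _∈ˡ?_)
  label : Fin (3 + r * 6) → Vertex r
  label = Inverse.to (vertex↔ r)
  E : Rel (Vertex r) 0ℓ
  E u v = (u , v) ∈ˡ edgeList k ⊎ (v , u) ∈ˡ edgeList k
  loopless : ∀ {u} → ¬ (u , u) ∈ˡ edgeList k
  loopless u∈ = All.lookup (edges-proper k) u∈ refl

{-# OPTIONS --safe #-}
-- A vertex cover of G_r has at least three guards in each gadget, and exactly three
-- only if they stand on a₁, a₃, a₅.  Attack a₄a₅ in such a tight gadget i: the guard
-- of a₅ moves to a₄, and as two of a₃, a₅, a₆ must be guarded afterwards, at least one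
-- net guard enters from gadget i + 1.  Follow this flow to the right.  A gadget that is
-- tight before and after the move lets no net flow through its left boundary; every
-- gadget before the first such one holds at least 7 guards before and after the move
-- together.  So the flow makes the gadgets from i up to there hold 3.5 guards on
-- average, except that the last run may gain a guard from x.  Cutting the chain into
-- such runs, the gadgets hold at least 3.5r - 0.5 guards in total, and the triangle xyz
-- at least two more.  A vertex cover with 3r + 2 vertices then bounds the ratio.
module Submission where

open import Data.Integer using (+_)
open import Data.Nat using (ℕ; NonZero)
open import Data.Product using (_×_; Σ-syntax; ∃-syntax)
open import Defs

import Algebra.Properties.AbelianGroup as AbelianGroupProperties
open import Data.Bool using (Bool; true; false; T; _∧_; _∨_; if_then_else_)
open import Data.Empty using (⊥-elim)
open import Data.Fin using (Fin; zero; suc; inject₁; fromℕ; toℕ; combine; _↑ˡ_; _↑ʳ_)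
open import Data.Fin.Induction using (<-weakInduction)
open import Data.Fin.Patterns using (0F; 1F; 2F; 3F; 4F; 5F)
import Data.Fin.Permutation as Permutation
import Data.Fin.Properties as Fin
open import Data.Fin.Relation.Unary.Top using (View; view; ‵fromℕ; ‵inject₁; view-inject₁; view-fromℕ)
open import Data.Fin.Subset using (Subset; _∈_; ∣_∣; ⁅_⁆; ⊥)
open import Data.Fin.Subset.Properties using (x∈p⇒∣p-x∣<∣p∣; p⊆q⇒∣p∣≤∣q∣; x∈p∧x≢y⇒x∈p-y; ∣⊥∣≡0; p─⊥≡p; p─q⊆p)
import Data.Integer as ℤ
import Data.Integer.Properties as ℤ
open import Data.List using (List; []; _∷_; map; length; allFin; concatMap)
open import Data.List.Membership.Propositional using (find) renaming (_∈_ to _∈ˡ_)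
open import Data.List.Membership.Propositional.Properties using (∈-++⁺ˡ; ∈-++⁺ʳ; ∈-++⁻; ∈-concatMap⁺; ∈-concatMap⁻; ∈-allFin; ∈-map⁺; ∈-map⁻)
open import Data.List.Properties using (length-map)
open import Data.List.Relation.Unary.All using (All; []; _∷_)
import Data.List.Relation.Unary.All as All
open import Data.List.Relation.Unary.AllPairs using ([]; _∷_)
open import Data.List.Relation.Unary.Any using (here; there)
import Data.List.Relation.Unary.Any as Any
open import Data.List.Relation.Unary.Any.Properties using (¬Any[])
open import Data.List.Relation.Unary.Unique.Propositional using (Unique)
import Data.List.Relation.Unary.Unique.Propositional.Properties as Unique
open import Data.Nat using (zero; suc; z≤n; s≤s; >-nonZero)
open import Data.Nat.GeneralisedArithmetic using (iterate)
import Data.Nat.ListAction as ℕᴸ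
import Data.Nat as ℕ
import Data.Nat.Properties as ℕ
open import Data.Nat.Tactic.RingSolver using (solve-∀)
open import Data.Product using (_,_; proj₁; proj₂)
import Data.Rational as ℚ
import Data.Rational.Properties as ℚ
open import Data.Rational.Unnormalised using (mkℚᵘ; *≤*; _≃_)
import Data.Rational.Unnormalised as ℚᵘ
import Data.Rational.Unnormalised.Properties as ℚᵘ
open import Data.Sum using (_⊎_; inj₁; inj₂; [_,_]′; swap; map₂)
open import Data.Sum.Properties using (inj₂-injective)
open import Data.Vec using (tabulate; lookup; []; _∷_; there)
open import Data.Vec.Properties using ([]=⇒lookup; lookup⇒[]=; lookup∘tabulate)
open import Function using (_∘_; Inverse; Equivalence; mk⇔)
open import Relation.Binary using (tri<; tri≈; tri>)
open import Relation.Binary.PropositionalEquality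
open import Relation.Nullary using (¬_; Dec; does; yes; no)
open import Relation.Nullary.Decidable using (¬?; _×-dec_; _⊎-dec_; dec-true; dec-false)
open import Algebra.Properties.CommutativeMonoid.Sum ℕ.+-0-commutativeMonoid using (sum; sum-cong-≗; ∑-distrib-+; ∑-comm)

-- The runs are never constructed. Where the flow started in a tight gadget stops depends on the
-- response to the attack, so the induction goes from the right and keeps the density bound for
-- every suffix of the chain. Wherever the flow stops, the bound for the suffix beginning there
-- finishes the estimate. All attacks are made on one fixed configuration. The responses for
-- different tight gadgets may be mutually incompatible, but each is used only through an inequality
-- on the guard counts before the move: the counts afterwards are eliminated by conservation of
-- guards. Hence a single round of the game suffices. Halves are avoided by doubling: 3.5 per gadget
-- becomes 7, compared with twice the number of guards. Net flows are kept as pairs of opposite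
-- flows, so that everything stays in the natural numbers.

module Chains where

  -- Guard flow along an abstract chain of cells.

  open import Data.Nat using (_+_; _*_; _≤_)

  -- A certificate for linear arithmetic: `y - x` equals `(q - p) + s`, with `s` the slack. The
  -- hypotheses of a later estimate are added up to `p ≤ q`, and what remains is an identity for the
  -- ring solver.
  ≤-by-difference : ∀ {x y p q} s → p ≤ q → x + q + s ≡ y + p → x ≤ y
  ≤-by-difference {x} {y} {p} {q} s p≤q e = ℕ.+-cancelʳ-≤ q x y (begin
    x + q      ≤⟨ ℕ.m≤m+n _ s ⟩
    x + q + s  ≡⟨ e ⟩
    y + p      ≤⟨ ℕ.+-monoʳ-≤ y p≤q ⟩
    y + q      ∎)
    where open ℕ.≤-Reasoning

  -- A chain of suc k cells holds n i guards before a move and n′ i after it; inˡ, outˡ,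
  -- inʳ, outʳ count the guards crossing the left and the right boundary of each cell.
  record Move {k} (n : Fin (suc k) → ℕ) : Set where
    field
      n′ inˡ outˡ inʳ outʳ : Fin (suc k) → ℕ
      conserved : ∀ i → n i + inˡ i + inʳ i ≡ n′ i + outˡ i + outʳ i
      link-in   : ∀ j → inˡ (suc j) ≡ outʳ (inject₁ j)
      link-out  : ∀ j → outˡ (suc j) ≡ inʳ (inject₁ j)
      end       : inʳ (fromℕ k) ≤ 1
      wall      : ∀ i → 7 ≤ n i + n′ i ⊎ outˡ i ≤ inˡ i

  open Move

  -- The flow through the left end of a chain is arbitrary, so the inflow from a deleted cell may
  -- become the inflow at the new left end.
  tailMove : ∀ {k} {n : Fin (suc (suc k)) → ℕ} → Move n → Move (n ∘ suc)
  tailMove M = record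
    { n′        = M .n′ ∘ suc
    ; inˡ       = M .inˡ ∘ suc
    ; outˡ      = M .outˡ ∘ suc
    ; inʳ       = M .inʳ ∘ suc
    ; outʳ      = M .outʳ ∘ suc
    ; conserved = M .conserved ∘ suc
    ; link-in   = M .link-in ∘ suc
    ; link-out  = M .link-out ∘ suc
    ; end       = M .end
    ; wall      = M .wall ∘ suc
    }

  -- Twice the bound of 3.5 guards per cell less one half; the 1 is the guard that may enter the
  -- last cell from x.
  Dense : ∀ {k} → (Fin (suc k) → ℕ) → Set
  Dense {k} n = 7 * suc k ≤ 2 * sum n + 1

  DenseSuffixes : ∀ {k} → (Fin (suc k) → ℕ) → Set
  DenseSuffixes {zero}  n = Dense n
  DenseSuffixes {suc k} n = Dense n × DenseSuffixes (n ∘ suc)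

  dense : ∀ {k} {n : Fin (suc k) → ℕ} → DenseSuffixes n → Dense n
  dense {zero}  d = d
  dense {suc k} d = proj₁ d

  -- Up to the first cell where no net flow leaves to the left, each cell holds at
  -- least 7 guards before and after the move together.
  flow-bound : ∀ {k} {n : Fin (suc k) → ℕ} → DenseSuffixes n → (M : Move n) →
               7 * suc k + M .outˡ zero ≤ 2 * sum n + 1 + M .inˡ zero
  flow-bound d M with M .wall zero
  -- The flow stops at this cell, and density of the suffix starting here takes over.
  flow-bound d M | inj₂ w = ℕ.+-mono-≤ (dense d) w
  -- Conservation eliminates `n′`: 7 is at most `2 * n zero` plus the net inflows on the left and on
  -- the right, and `end` bounds the latter by 1.
  flow-bound {zero} {n} d M | inj₁ h =
    ≤-by-difference (M .outʳ zero) (ℕ.+-mono-≤ h (M .end))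
      (trans (lhs (M .outˡ zero) (n zero) (M .n′ zero) (M .outʳ zero))
      (trans (cong (_+ (n zero + 8)) (sym (M .conserved zero)))
             (rhs (n zero) (M .inˡ zero) (M .inʳ zero))))
    where
    lhs : ∀ o a b r → 7 + o + (a + b + 1) + r ≡ (b + o + r) + (a + 8)
    lhs = solve-∀
    rhs : ∀ a i j → (a + i + j) + (a + 8) ≡ 2 * (a + 0) + 1 + i + (7 + j)
    rhs = solve-∀
  -- The net inflow on the right of this cell is the net outflow on the left of the tail, so adding
  -- the bound for the tail cancels it and leaves only the left boundary.
  flow-bound {suc k} {n} (_ , d) M | inj₁ h =
    ≤-by-difference 0 (ℕ.+-mono-≤ h ih)
      (trans (lhs k (M .outˡ zero) (n zero) (M .n′ zero) (sum (n ∘ suc)) (M .outʳ zero))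
      (trans (cong (_+ (n zero + 2 * sum (n ∘ suc) + 15 + 7 * k)) (sym (M .conserved zero)))
             (rhs k (n zero) (M .inˡ zero) (sum (n ∘ suc)) (M .inʳ zero))))
    where
    ih : 7 * suc k + M .inʳ zero ≤ 2 * sum (n ∘ suc) + 1 + M .outʳ zero
    ih = subst₂ (λ o i → 7 * suc k + o ≤ 2 * sum (n ∘ suc) + 1 + i)
           (M .link-out zero) (M .link-in zero) (flow-bound d (tailMove M))
    lhs : ∀ k o a b s r → 7 * (2 + k) + o + (a + b + (2 * s + 1 + r)) + 0 ≡ (b + o + r) + (a + 2 * s + 15 + 7 * k)
    lhs = solve-∀
    rhs : ∀ k a i s j → (a + i + j) + (a + 2 * s + 15 + 7 * k) ≡ 2 * (a + s) + 1 + i + (7 + (7 * (1 + k) + j))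
    rhs = solve-∀

  Forcing : ∀ {k} → (Fin (suc k) → ℕ) → Fin (suc k) → Set
  Forcing n i = Σ[ M ∈ Move n ] M .outʳ i + 1 ≤ M .inʳ i

  denseSuffixes : ∀ {k} {n : Fin (suc k) → ℕ} →
                  (∀ i → 4 ≤ n i ⊎ (3 ≤ n i × Forcing n i)) → DenseSuffixes n
  -- For a single cell the allowance of 1 already pays for the missing half guard.
  denseSuffixes {zero} {n} f = 7≤2s+1 (3≤ (f zero))
    where
    3≤ : ∀ {a} {B : Set} → 4 ≤ a ⊎ (3 ≤ a × B) → 3 ≤ a
    3≤ (inj₁ h)       = ℕ.≤-trans (ℕ.n≤1+n 3) h
    3≤ (inj₂ (h , _)) = h
    7≤2s+1 : ∀ {a} → 3 ≤ a → 7 ≤ 2 * (a + 0) + 1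
    7≤2s+1 h = ℕ.+-monoˡ-≤ 1 (ℕ.*-monoʳ-≤ 2 (ℕ.≤-trans h (ℕ.m≤m+n _ 0)))
  denseSuffixes {suc k} {n} f = head (f zero) , d
    where
    f′ : ∀ i → 4 ≤ n (suc i) ⊎ (3 ≤ n (suc i) × Forcing (n ∘ suc) i)
    f′ i with f (suc i)
    ... | inj₁ h             = inj₁ h
    ... | inj₂ (h , M , net) = inj₂ (h , tailMove M , net)
    d : DenseSuffixes (n ∘ suc)
    d = denseSuffixes f′
    head : 4 ≤ n zero ⊎ (3 ≤ n zero × Forcing n zero) → 7 * suc (suc k) ≤ 2 * sum n + 1
    head (inj₁ h) = ≤-by-difference 1 (ℕ.+-mono-≤ (ℕ.*-monoʳ-≤ 2 h) (dense d)) (id₁ k (n zero) (sum (n ∘ suc)))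
      where
      id₁ : ∀ k a s → 7 * (2 + k) + (2 * a + (2 * s + 1)) + 1 ≡ 2 * (a + s) + 1 + (8 + (7 * (1 + k)))
      id₁ = solve-∀
    -- Three guards, doubled, fall one short of 7. The tail has a surplus of at least one by
    -- `flow-bound`, since the forced move sends net flow out of it to the left.
    head (inj₂ (h , M , net)) =
      ≤-by-difference 0 (ℕ.+-mono-≤ (ℕ.*-monoʳ-≤ 2 h) (ℕ.+-mono-≤ net ih))
        (id₂ k (n zero) (sum (n ∘ suc)) (M .inʳ zero) (M .outʳ zero))
      where
      ih : 7 * suc k + M .inʳ zero ≤ 2 * sum (n ∘ suc) + 1 + M .outʳ zero
      ih = subst₂ (λ o i → 7 * suc k + o ≤ 2 * sum (n ∘ suc) + 1 + i)
             (M .link-out zero) (M .link-in zero) (flow-bound d (tailMove M))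
      id₂ : ∀ k a s i o → 7 * (2 + k) + (2 * a + (i + (2 * s + 1 + o))) + 0 ≡
                          2 * (a + s) + 1 + (6 + (o + 1 + (7 * (1 + k) + i)))
      id₂ = solve-∀

-- The edges of the graph, guard configurations and their cardinality.

module Counting where

  open import Data.Nat using (_+_; _*_; _≤_)

  open Chains

  ∑-blocks : ∀ r (f : Fin (r * 6) → ℕ) → sum f ≡ sum (λ (i : Fin r) → sum (λ (t : Fin 6) → f (combine i t)))
  ∑-blocks zero    f = refl
  ∑-blocks (suc r) f = begin
    sum f
      ≡⟨⟩
    f 0F + (f 1F + (f 2F + (f 3F + (f 4F + (f 5F + sum f′)))))
      ≡⟨ cong (λ s → f 0F + (f 1F + (f 2F + (f 3F + (f 4F + (f 5F + s)))))) (∑-blocks r f′) ⟩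
    f 0F + (f 1F + (f 2F + (f 3F + (f 4F + (f 5F + s′)))))
      ≡⟨ reassociate (f 0F) (f 1F) (f 2F) (f 3F) (f 4F) (f 5F) s′ ⟩
    sum (λ (t : Fin 6) → f (t ↑ˡ (r * 6))) + s′
      ∎
    where
    open ≡-Reasoning
    f′ : Fin (r * 6) → ℕ
    f′ = f ∘ (6 ↑ʳ_)
    s′ : ℕ
    s′ = sum (λ (i : Fin r) → sum (λ (t : Fin 6) → f′ (combine i t)))
    reassociate : ∀ a b c d e g s → a + (b + (c + (d + (e + (g + s))))) ≡ (a + (b + (c + (d + (e + (g + 0)))))) + s
    reassociate = solve-∀

  bit : Bool → ℕ
  bit true  = 1
  bit false = 0

  ∣∣≡∑ : ∀ {n} (S : Subset n) → ∣ S ∣ ≡ sum (bit ∘ lookup S)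
  ∣∣≡∑ []          = refl
  ∣∣≡∑ (true  ∷ S) = cong suc (∣∣≡∑ S)
  ∣∣≡∑ (false ∷ S) = ∣∣≡∑ S

  module _ {k : ℕ} where

    private
      V : Set
      V = Vertex (suc k)

    -- The edge list as an inductive family, so that matching on an edge with a known endpoint
    -- leaves exactly the possible neighbours.
    data Edge : V → V → Set where
      xy  : Edge xᵥ yᵥ
      xz  : Edge xᵥ zᵥ
      yz  : Edge yᵥ zᵥ
      za  : Edge zᵥ (a₂ zero)
      ya  : Edge yᵥ (a₁ zero)
      ax  : Edge (a₆ (fromℕ k)) xᵥ
      e12 : ∀ i → Edge (a₁ i) (a₂ i)
      e23 : ∀ i → Edge (a₂ i) (a₃ i)
      e34 : ∀ i → Edge (a₃ i) (a₄ i)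
      e35 : ∀ i → Edge (a₃ i) (a₅ i)
      e36 : ∀ i → Edge (a₃ i) (a₆ i)
      e14 : ∀ i → Edge (a₁ i) (a₄ i)
      e45 : ∀ i → Edge (a₄ i) (a₅ i)
      e56 : ∀ i → Edge (a₅ i) (a₆ i)
      l32 : ∀ j → Edge (a₃ (inject₁ j)) (a₂ (suc j))
      l61 : ∀ j → Edge (a₆ (inject₁ j)) (a₁ (suc j))

    Adjacent : V → V → Set
    Adjacent u v = Edge u v ⊎ Edge v u

    private
      gadget∈ : ∀ i {e} → e ∈ˡ gadgetEdges i → e ∈ˡ edgeList k
      gadget∈ i e∈ = ∈-++⁺ʳ (outerEdges k) (∈-++⁺ˡ (∈-concatMap⁺ gadgetEdges (Any.map (λ { refl → e∈ }) (∈-allFin i))))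

      link∈ : ∀ j {e} → e ∈ˡ linkEdges j → e ∈ˡ edgeList k
      link∈ j e∈ = ∈-++⁺ʳ (outerEdges k) (∈-++⁺ʳ (concatMap gadgetEdges (allFin (suc k)))
        (∈-concatMap⁺ linkEdges (Any.map (λ { refl → e∈ }) (∈-allFin j))))

    edge∈ : ∀ {u v} → Edge u v → (u , v) ∈ˡ edgeList k
    edge∈ xy = here refl
    edge∈ xz = there (here refl)
    edge∈ yz = there (there (here refl))
    edge∈ za = there (there (there (here refl)))
    edge∈ ya = there (there (there (there (here refl))))
    edge∈ ax = there (there (there (there (there (here refl)))))
    edge∈ (e12 i) = gadget∈ i (here refl)
    edge∈ (e23 i) = gadget∈ i (there (here refl))
    edge∈ (e34 i) = gadget∈ i (there (there (here refl)))
    edge∈ (e35 i) = gadget∈ i (there (there (there (here refl))))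
    edge∈ (e36 i) = gadget∈ i (there (there (there (there (here refl)))))
    edge∈ (e14 i) = gadget∈ i (there (there (there (there (there (here refl))))))
    edge∈ (e45 i) = gadget∈ i (there (there (there (there (there (there (here refl)))))))
    edge∈ (e56 i) = gadget∈ i (there (there (there (there (there (there (there (here refl))))))))
    edge∈ (l32 j) = link∈ j (here refl)
    edge∈ (l61 j) = link∈ j (there (here refl))

    ∈edge : ∀ {u v} → (u , v) ∈ˡ edgeList k → Edge u v
    ∈edge e∈ with ∈-++⁻ (outerEdges k) e∈
    ... | inj₁ (here refl) = xy
    ... | inj₁ (there (here refl)) = xz
    ... | inj₁ (there (there (here refl))) = yz
    ... | inj₁ (there (there (there (here refl)))) = za
    ... | inj₁ (there (there (there (there (here refl))))) = ya
    ... | inj₁ (there (there (there (there (there (here refl)))))) = ax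
    ... | inj₂ e∈′ with ∈-++⁻ (concatMap gadgetEdges (allFin (suc k))) e∈′
    ...   | inj₁ e∈″ = gadget (proj₂ (proj₂ (find (∈-concatMap⁻ gadgetEdges {xs = allFin (suc k)} e∈″))))
      where
      gadget : ∀ {i u v} → (u , v) ∈ˡ gadgetEdges i → Edge u v
      gadget (here refl) = e12 _
      gadget (there (here refl)) = e23 _
      gadget (there (there (here refl))) = e34 _
      gadget (there (there (there (here refl)))) = e35 _
      gadget (there (there (there (there (here refl))))) = e36 _
      gadget (there (there (there (there (there (here refl)))))) = e14 _
      gadget (there (there (there (there (there (there (here refl))))))) = e45 _
      gadget (there (there (there (there (there (there (there (here refl)))))))) = e56 _
    ...   | inj₂ e∈″ = link (proj₂ (proj₂ (find (∈-concatMap⁻ linkEdges {xs = allFin k} e∈″))))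
      where
      link : ∀ {j u v} → (u , v) ∈ˡ linkEdges j → Edge u v
      link (here refl) = l32 _
      link (there (here refl)) = l61 _

    abstract
      -- The numbering of the vertices is sealed: outside this block only the inverse laws, the
      -- adjacency translations and the sum formula are visible, and arguments take place on
      -- `Vertex`.
      label : Fin (3 + suc k * 6) → V
      label = Inverse.to (vertex↔ (suc k))

      vertex : V → Fin (3 + suc k * 6)
      vertex = Inverse.from (vertex↔ (suc k))

      label-vertex : ∀ v → label (vertex v) ≡ v
      label-vertex = Inverse.strictlyInverseˡ (vertex↔ (suc k))

      vertex-label : ∀ u → vertex (label u) ≡ u
      vertex-label = Inverse.strictlyInverseʳ (vertex↔ (suc k))

      adj⇒ : ∀ u v → Adj (G (suc k)) u v → Adjacent (label u) (label v)
      adj⇒ u v = [ inj₁ ∘ ∈edge , inj₂ ∘ ∈edge ]′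

      adj⇐ : ∀ u v → Adjacent (label u) (label v) → Adj (G (suc k)) u v
      adj⇐ u v = [ inj₁ ∘ edge∈ , inj₂ ∘ edge∈ ]′

      ∑-vertices : ∀ (f : Fin (3 + suc k * 6) → ℕ) →
                   sum f ≡ f (vertex xᵥ) + (f (vertex yᵥ) + (f (vertex zᵥ) +
                           sum (λ (i : Fin (suc k)) → sum (λ (t : Fin 6) → f (vertex (inj₂ (i , t)))))))
      ∑-vertices f = cong (λ s → f 0F + (f 1F + (f 2F + s))) (∑-blocks (suc k) (λ j → f (suc (suc (suc j)))))

    label-injective : ∀ {u v} → label u ≡ label v → u ≡ v
    label-injective {u} {v} e = trans (sym (vertex-label u)) (trans (cong vertex e) (vertex-label v))

    vertex-injective : ∀ {u v} → vertex u ≡ vertex v → u ≡ v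
    vertex-injective {u} {v} e = trans (sym (label-vertex u)) (trans (cong label e) (label-vertex v))

    vertex-adj : ∀ {u v} → Adjacent u v → Adj (G (suc k)) (vertex u) (vertex v)
    vertex-adj {u} {v} a = adj⇐ _ _ (subst₂ Adjacent (sym (label-vertex u)) (sym (label-vertex v)) a)

    -- The flow balance concerns every reconfiguration; the attack enters later, as the equation on
    -- `φ (a₅ i)` in `influx`.
    record Defence (C C′ : V → Bool) (φ : V → V) : Set where
      field
        into       : ∀ w → C w ≡ true → C′ (φ w) ≡ true
        injective  : ∀ w w′ → C w ≡ true → C w′ ≡ true → φ w ≡ φ w′ → w ≡ w′
        surjective : ∀ w′ → C′ w′ ≡ true → ∃[ w ] C w ≡ true × φ w ≡ w′
        step       : ∀ w → C w ≡ true → φ w ≡ w ⊎ Adjacent w (φ w)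

    guards : Subset (3 + suc k * 6) → V → Bool
    guards C v = lookup C (vertex v)

    -- In Boolean form an uncovered edge has the empty type as soon as both memberships are
    -- literals, so case analyses discard it by absurd patterns.
    record Covers (C : V → Bool) : Set where
      field
        meets : ∀ {u v} → Edge u v → T (C u ∨ C v)

    covers : ∀ {C} → VertexCover (G (suc k)) C → Covers (guards C)
    covers {C} cov .Covers.meets {u} {v} e with cov (vertex u) (vertex v) (vertex-adj (inj₁ e))
    ... | inj₁ u∈ rewrite []=⇒lookup u∈ = _
    ... | inj₂ v∈ rewrite []=⇒lookup v∈ with guards C u
    ...   | true  = _
    ...   | false = _

    onLabels : (Fin (3 + suc k * 6) → Fin (3 + suc k * 6)) → V → V
    onLabels φ = label ∘ φ ∘ vertex

    defence : ∀ {u v C C′ φ} → IsDefence (G (suc k)) u v C C′ φ → Defence (guards C) (guards C′) (onLabels φ)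
    defence {C = C} {C′} {φ} d = record
      { into       = λ w h → trans (cong (lookup C′) (vertex-label _)) ([]=⇒lookup (D.into _ (∈C w h)))
      ; injective  = λ w w′ h h′ e → vertex-injective (D.injective _ _ (∈C w h) (∈C w′ h′) (label-injective e))
      ; surjective = λ w′ h′ → let (w , w∈ , e) = D.surjective _ (lookup⇒[]= _ C′ h′) in
          label w , trans (cong (lookup C) (vertex-label w)) ([]=⇒lookup w∈)
                  , trans (cong (label ∘ φ) (vertex-label w)) (trans (cong label e) (label-vertex w′))
      ; step       = λ w h → [ (λ e → inj₁ (trans (cong label e) (label-vertex w)))
                             , (λ a → inj₂ (subst (λ z → Adjacent z (label (φ (vertex w)))) (label-vertex w) (adj⇒ (vertex w) (φ (vertex w)) a))) ]′
                             (D.step (vertex w) (∈C w h))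
      }
      where
      module D = IsDefence d
      ∈C : ∀ w → guards C w ≡ true → vertex w ∈ C
      ∈C w = lookup⇒[]= (vertex w) C

  ∑ᴸ : ∀ {A : Set} → List A → (A → Bool) → ℕ
  ∑ᴸ L b = ℕᴸ.sum (map (bit ∘ b) L)

  ∑ᴸ-none : ∀ {A : Set} (L : List A) {b : A → Bool} → All (λ u → b u ≡ false) L → ∑ᴸ L b ≡ 0
  ∑ᴸ-none []      []       = refl
  ∑ᴸ-none (u ∷ L) (h ∷ hs) rewrite h = ∑ᴸ-none L hs

  ∑ᴸ-one : ∀ {A : Set} {L : List A} {b : A → Bool} {x} → Unique L → x ∈ˡ L → b x ≡ true →
           (∀ u → b u ≡ true → u ≡ x) → ∑ᴸ L b ≡ 1
  ∑ᴸ-one {L = u ∷ L} {b} (u∉ ∷ uniq) (here refl) bx only rewrite bx =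
    cong suc (∑ᴸ-none L (All.map others u∉))
    where
    others : ∀ {v} → u ≢ v → b v ≡ false
    others {v} u≢v with b v in e
    ... | true  = ⊥-elim (u≢v (sym (only v e)))
    ... | false = refl
  ∑ᴸ-one {L = u ∷ L} {b} (u∉ ∷ uniq) (there x∈) bx only with b u in e
  ... | false = ∑ᴸ-one uniq x∈ bx only
  ... | true  = ⊥-elim (All.lookup u∉ x∈ (only u e))

  -- Serves both directions of the flow: for departures the uniqueness hypothesis holds because `φ`
  -- is a function, for arrivals because it is injective.
  ∑ᴸ-bit : ∀ {A : Set} {L : List A} {b : A → Bool} (t : Bool) → Unique L →
           (t ≡ true → ∃[ x ] x ∈ˡ L × b x ≡ true) → (∀ u → b u ≡ true → t ≡ true) →
           (∀ u v → b u ≡ true → b v ≡ true → u ≡ v) → bit t ≡ ∑ᴸ L b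
  ∑ᴸ-bit true uniq some _ only with some refl
  ... | x , x∈ , bx = sym (∑ᴸ-one uniq x∈ bx (λ u bu → only u x bu bx))
  ∑ᴸ-bit {L = L} {b} false uniq _ if _ = sym (∑ᴸ-none L (All.tabulate λ {u} _ → none u))
    where
    none : ∀ u → b u ≡ false
    none u with b u in e
    ... | false = refl
    ... | true  with () ← if u e

  -- Flow between neighbouring gadgets and its conservation.

  module _ {k : ℕ} where

    private
      V : Set
      V = Vertex (suc k)

    -- The outer neighbours of a₂ i, a₁ i, a₃ i, a₆ i.  In the last gadget a₃ has none, and
    -- nextTop is then the non-neighbour xᵥ, to which no guard moves.
    prevTop prevBottom nextTop nextBottom : Fin (suc k) → V
    prevTop zero    = zᵥ
    prevTop (suc j) = a₃ (inject₁ j)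
    prevBottom zero    = yᵥ
    prevBottom (suc j) = a₆ (inject₁ j)
    nextTop i with view i
    ... | ‵fromℕ     = xᵥ
    ... | ‵inject₁ j = a₂ (suc j)
    nextBottom i with view i
    ... | ‵fromℕ     = xᵥ
    ... | ‵inject₁ j = a₁ (suc j)

    nextTop-inject₁ : ∀ j → nextTop (inject₁ j) ≡ a₂ (suc j)
    nextTop-inject₁ j rewrite view-inject₁ j = refl

    nextBottom-inject₁ : ∀ j → nextBottom (inject₁ j) ≡ a₁ (suc j)
    nextBottom-inject₁ j rewrite view-inject₁ j = refl

    nextTop-fromℕ : nextTop (fromℕ k) ≡ xᵥ
    nextTop-fromℕ rewrite view-fromℕ k = refl

    nextBottom-fromℕ : nextBottom (fromℕ k) ≡ xᵥ
    nextBottom-fromℕ rewrite view-fromℕ k = refl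

    Outside : Fin (suc k) → V → Set
    Outside i v = ∀ t → v ≢ inj₂ (i , t)

    consecutive : ∀ {j : Fin k} {t s : Fin 6} → _≢_ {A = V} (inj₂ (inject₁ j , t)) (inj₂ (suc j , s))
    consecutive {j} e = Fin.<⇒≢ (Fin.≤̄⇒inject₁< {i = j} {j = j} ℕ.≤-refl) (cong proj₁ (inj₂-injective e))

    prevTop-outside : ∀ i → Outside i (prevTop i)
    prevTop-outside zero    t ()
    prevTop-outside (suc j) t = consecutive

    prevBottom-outside : ∀ i → Outside i (prevBottom i)
    prevBottom-outside zero    t ()
    prevBottom-outside (suc j) t = consecutive

    nextTop-outside : ∀ i → Outside i (nextTop i)
    nextTop-outside i t with view i
    ... | ‵fromℕ     = λ ()
    ... | ‵inject₁ j = consecutive ∘ sym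

    nextBottom-outside : ∀ i → Outside i (nextBottom i)
    nextBottom-outside i t with view i
    ... | ‵fromℕ     = λ ()
    ... | ‵inject₁ j = consecutive ∘ sym

    gadget : Fin (suc k) → List V
    gadget i = a₁ i ∷ a₂ i ∷ a₃ i ∷ a₄ i ∷ a₅ i ∷ a₆ i ∷ []

    gadget-unique : ∀ i → Unique (gadget i)
    gadget-unique i =
      ((λ ()) ∷ (λ ()) ∷ (λ ()) ∷ (λ ()) ∷ (λ ()) ∷ []) ∷
      ((λ ()) ∷ (λ ()) ∷ (λ ()) ∷ (λ ()) ∷ []) ∷
      ((λ ()) ∷ (λ ()) ∷ (λ ()) ∷ []) ∷
      ((λ ()) ∷ (λ ()) ∷ []) ∷
      ((λ ()) ∷ []) ∷ [] ∷ []

    outside-unique : ∀ {i v} → Outside i v → Unique (v ∷ gadget i)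
    outside-unique {i} o = (o 0F ∷ o 1F ∷ o 2F ∷ o 3F ∷ o 4F ∷ o 5F ∷ []) ∷ gadget-unique i

    -- `L` may exceed the closed neighbourhood of `v`. Taking the whole gadget each time makes the
    -- internal flows a full 6 by 6 matrix, which is what cancels in `conserved`.
    Near : V → List V → Set
    Near v L = ∀ {u} → u ≡ v ⊎ Adjacent u v → u ∈ˡ L

    near₁ : ∀ i → Near (a₁ i) (prevBottom i ∷ gadget i)
    near₁ i (inj₁ refl) = there (here refl)
    near₁ i (inj₂ (inj₁ ya)) = here refl
    near₁ i (inj₂ (inj₁ (l61 j))) = here refl
    near₁ i (inj₂ (inj₂ (e12 _))) = there (there (here refl))
    near₁ i (inj₂ (inj₂ (e14 _))) = there (there (there (there (here refl))))

    near₂ : ∀ i → Near (a₂ i) (prevTop i ∷ gadget i)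
    near₂ i (inj₁ refl) = there (there (here refl))
    near₂ i (inj₂ (inj₁ za)) = here refl
    near₂ i (inj₂ (inj₁ (l32 j))) = here refl
    near₂ i (inj₂ (inj₁ (e12 _))) = there (here refl)
    near₂ i (inj₂ (inj₂ (e23 _))) = there (there (there (here refl)))

    near₃ : ∀ i → Near (a₃ i) (nextTop i ∷ gadget i)
    near₃ i (inj₁ refl) = there (there (there (here refl)))
    near₃ i (inj₂ (inj₁ (e23 _))) = there (there (here refl))
    near₃ i (inj₂ (inj₂ (e34 _))) = there (there (there (there (here refl))))
    near₃ i (inj₂ (inj₂ (e35 _))) = there (there (there (there (there (here refl)))))
    near₃ i (inj₂ (inj₂ (e36 _))) = there (there (there (there (there (there (here refl))))))
    near₃ i (inj₂ (inj₂ (l32 j))) = here (sym (nextTop-inject₁ j))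

    near₄ : ∀ i → Near (a₄ i) (gadget i)
    near₄ i (inj₁ refl) = there (there (there (here refl)))
    near₄ i (inj₂ (inj₁ (e34 _))) = there (there (here refl))
    near₄ i (inj₂ (inj₁ (e14 _))) = here refl
    near₄ i (inj₂ (inj₂ (e45 _))) = there (there (there (there (here refl))))

    near₅ : ∀ i → Near (a₅ i) (gadget i)
    near₅ i (inj₁ refl) = there (there (there (there (here refl))))
    near₅ i (inj₂ (inj₁ (e35 _))) = there (there (here refl))
    near₅ i (inj₂ (inj₁ (e45 _))) = there (there (there (here refl)))
    near₅ i (inj₂ (inj₂ (e56 _))) = there (there (there (there (there (here refl)))))

    near₆ : ∀ i → Near (a₆ i) (nextBottom i ∷ gadget i)
    near₆ i (inj₁ refl) = there (there (there (there (there (there (here refl))))))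
    near₆ i (inj₂ (inj₁ (e36 _))) = there (there (there (here refl)))
    near₆ i (inj₂ (inj₁ (e56 _))) = there (there (there (there (there (here refl)))))
    near₆ i (inj₂ (inj₂ ax)) = here (sym nextBottom-fromℕ)
    near₆ i (inj₂ (inj₂ (l61 j))) = here (sym (nextBottom-inject₁ j))

    guardCount : (V → Bool) → Fin (suc k) → ℕ
    guardCount C i = sum λ t → bit (C (inj₂ (i , t)))

    module Flow {C C′ : V → Bool} {φ : V → V} (d : Defence C C′ φ) where
      open Defence d

      moves : V → V → Bool
      moves u v = C u ∧ does (φ u ≟ⱽ v)

      -- A guard that stays is a flow from its vertex to itself; thus the guard on a vertex is
      -- always the sum of the flows out of it, and the guard there afterwards the sum of the flows
      -- into it.
      flow : V → V → ℕ
      flow u v = bit (moves u v)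

      moves⇒ : ∀ {u v} → moves u v ≡ true → C u ≡ true × φ u ≡ v
      moves⇒ {u} {v} m with C u | φ u ≟ⱽ v
      moves⇒ m | true | yes e = refl , e

      moves⇐ : ∀ {u v} → C u ≡ true → φ u ≡ v → moves u v ≡ true
      moves⇐ {u} {v} c e rewrite c = dec-true (φ u ≟ⱽ v) e

      flow-out : ∀ v {L} → Unique L → Near v L → bit (C v) ≡ ∑ᴸ L (moves v)
      flow-out v uniq near = ∑ᴸ-bit (C v) uniq
        (λ c → φ v , near ([ inj₁ , (λ a → inj₂ ([ inj₂ , inj₁ ]′ a)) ]′ (step v c)) , moves⇐ c refl)
        (λ u m → proj₁ (moves⇒ m))
        (λ u w m m′ → trans (sym (proj₂ (moves⇒ m))) (proj₂ (moves⇒ m′)))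

      origin : ∀ {v} → C′ v ≡ true → ∃[ u ] moves u v ≡ true × (u ≡ v ⊎ Adjacent u v)
      origin {v} c′ with surjective v c′
      ... | u , c , refl = u , moves⇐ c refl , [ (λ e → inj₁ (sym e)) , inj₂ ]′ (step u c)

      flow-in : ∀ v {L} → Unique L → Near v L → bit (C′ v) ≡ ∑ᴸ L (λ u → moves u v)
      flow-in v uniq near = ∑ᴸ-bit (C′ v) uniq
        (λ c′ → let (u , m , n) = origin c′ in u , near n , m)
        (λ u m → let (c , e) = moves⇒ m in subst (λ w → C′ w ≡ true) e (into u c))
        (λ u w m m′ → let (c , e) = moves⇒ m ; (c′ , e′) = moves⇒ m′ in injective u w c c′ (trans e (sym e′)))

      flow-out≤1 : ∀ v {L} → Unique L → ∑ᴸ L (moves v) ≤ 1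
      flow-out≤1 v {[]} [] = z≤n
      flow-out≤1 v {u ∷ L} (u∉ ∷ uniq) with moves v u in e
      ... | false = flow-out≤1 v uniq
      ... | true  = s≤s (ℕ.≤-reflexive (∑ᴸ-none L (All.map none u∉)))
        where
        none : ∀ {w} → u ≢ w → moves v w ≡ false
        none {w} u≢w with moves v w in e′
        ... | false = refl
        ... | true  = ⊥-elim (u≢w (trans (sym (proj₂ (moves⇒ e))) (proj₂ (moves⇒ e′))))

      inˡ outˡ inʳ outʳ : Fin (suc k) → ℕ
      inˡ  i = flow (prevBottom i) (a₁ i) + flow (prevTop i) (a₂ i)
      outˡ i = flow (a₁ i) (prevBottom i) + flow (a₂ i) (prevTop i)
      inʳ  i = flow (nextTop i) (a₃ i) + flow (nextBottom i) (a₆ i)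
      outʳ i = flow (a₃ i) (nextTop i) + flow (a₆ i) (nextBottom i)

      -- Guards before are counted by destination, guards afterwards by origin. The internal flows
      -- give the same double sum in the two orders of summation, and only boundary flows remain.
      conserved : ∀ i → guardCount C i + inˡ i + inʳ i ≡ guardCount C′ i + outˡ i + outʳ i
      conserved i = begin
        guardCount C i + inˡ i + inʳ i
          ≡⟨ cong (λ s → s + inˡ i + inʳ i) (trans (sum-cong-≗ out≗) (∑-distrib-+ out λ t → sum (inner t))) ⟩
        sum out + sum (λ t → sum (inner t)) + inˡ i + inʳ i
          ≡⟨ cong (λ s → sum out + s + inˡ i + inʳ i) (∑-comm inner) ⟩
        sum out + sum (λ s → sum (λ t → inner t s)) + inˡ i + inʳ i
          ≡⟨ exchange (sum λ s → sum (λ t → inner t s))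
               (out 0F) (out 1F) (out 2F) (out 5F) (inn 0F) (inn 1F) (inn 2F) (inn 5F) ⟩
        sum inn + sum (λ s → sum (λ t → inner t s)) + outˡ i + outʳ i
          ≡⟨ cong (λ s → s + outˡ i + outʳ i) (trans (sum-cong-≗ in≗) (∑-distrib-+ inn λ s → sum (λ t → inner t s))) ⟨
        guardCount C′ i + outˡ i + outʳ i ∎
        where
        open ≡-Reasoning
        inner : Fin 6 → Fin 6 → ℕ
        inner t s = flow (inj₂ (i , t)) (inj₂ (i , s))
        out inn : Fin 6 → ℕ
        out 0F = flow (a₁ i) (prevBottom i)
        out 1F = flow (a₂ i) (prevTop i)
        out 2F = flow (a₃ i) (nextTop i)
        out 3F = 0
        out 4F = 0
        out 5F = flow (a₆ i) (nextBottom i)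
        inn 0F = flow (prevBottom i) (a₁ i)
        inn 1F = flow (prevTop i) (a₂ i)
        inn 2F = flow (nextTop i) (a₃ i)
        inn 3F = 0
        inn 4F = 0
        inn 5F = flow (nextBottom i) (a₆ i)
        out≗ : ∀ t → bit (C (inj₂ (i , t))) ≡ out t + sum (inner t)
        out≗ 0F = flow-out (a₁ i) (outside-unique (prevBottom-outside i)) (near₁ i)
        out≗ 1F = flow-out (a₂ i) (outside-unique (prevTop-outside i)) (near₂ i)
        out≗ 2F = flow-out (a₃ i) (outside-unique (nextTop-outside i)) (near₃ i)
        out≗ 3F = flow-out (a₄ i) (gadget-unique i) (near₄ i)
        out≗ 4F = flow-out (a₅ i) (gadget-unique i) (near₅ i)
        out≗ 5F = flow-out (a₆ i) (outside-unique (nextBottom-outside i)) (near₆ i)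
        in≗ : ∀ s → bit (C′ (inj₂ (i , s))) ≡ inn s + sum (λ t → inner t s)
        in≗ 0F = flow-in (a₁ i) (outside-unique (prevBottom-outside i)) (near₁ i)
        in≗ 1F = flow-in (a₂ i) (outside-unique (prevTop-outside i)) (near₂ i)
        in≗ 2F = flow-in (a₃ i) (outside-unique (nextTop-outside i)) (near₃ i)
        in≗ 3F = flow-in (a₄ i) (gadget-unique i) (near₄ i)
        in≗ 4F = flow-in (a₅ i) (gadget-unique i) (near₅ i)
        in≗ 5F = flow-in (a₆ i) (outside-unique (nextBottom-outside i)) (near₆ i)
        exchange : ∀ s a b c d a′ b′ c′ d′ →
          (a + (b + (c + (0 + (0 + (d + 0)))))) + s + (a′ + b′) + (c′ + d′) ≡
          (a′ + (b′ + (c′ + (0 + (0 + (d′ + 0)))))) + s + (a + b) + (c + d)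
        exchange = solve-∀

  open Covers

  bit≤ : ∀ {b n} → (b ≡ true → 1 ≤ n) → bit b ≤ n
  bit≤ {true}  h = h refl
  bit≤ {false} h = z≤n

  -- A cover misses at most one vertex of a triangle. Applied to xyz and to a₃a₅a₆.
  two-of-three : ∀ a b c → T (a ∨ b) → T (a ∨ c) → T (b ∨ c) → 2 ≤ bit a + (bit b + bit c)
  two-of-three true  true  _    _ _ _ = s≤s (s≤s z≤n)
  two-of-three true  false true _ _ _ = s≤s (s≤s z≤n)
  two-of-three false true  true _ _ _ = s≤s (s≤s z≤n)

  -- Covers of a gadget, forced flow and the lower bound for eternal classes.

  module _ {k : ℕ} where

    private
      V : Set
      V = Vertex (suc k)

    record Tight (C : V → Bool) (i : Fin (suc k)) : Set where
      field
        a₁∈ : C (a₁ i) ≡ true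
        a₂∉ : C (a₂ i) ≡ false
        a₃∈ : C (a₃ i) ≡ true
        a₄∉ : C (a₄ i) ≡ false
        a₅∈ : C (a₅ i) ≡ true
        a₆∉ : C (a₆ i) ≡ false

    -- If a₃ is unguarded, its four neighbours a₂, a₄, a₅, a₆ in the gadget are guarded. Otherwise
    -- the edges left to cover form the path a₂a₁a₄a₅a₆, whose only cover with at most two vertices
    -- consists of a₁ and a₅.
    gadget-cases : ∀ {C} → Covers C → ∀ i → 4 ≤ guardCount C i ⊎ Tight C i
    gadget-cases {C} cov i
      with C (a₁ i) in c₁ | C (a₂ i) in c₂ | C (a₃ i) in c₃ | C (a₄ i) in c₄ | C (a₅ i) in c₅ | C (a₆ i) in c₆
         | meets cov (e12 i) | meets cov (e23 i) | meets cov (e34 i) | meets cov (e35 i) | meets cov (e36 i) | meets cov (e14 i) | meets cov (e45 i) | meets cov (e56 i)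
    ... | true  | false | true  | false | true  | false | _ | _ | _ | _ | _ | _ | _ | _ = inj₂ (record
            { a₁∈ = c₁ ; a₂∉ = c₂ ; a₃∈ = c₃ ; a₄∉ = c₄ ; a₅∈ = c₅ ; a₆∉ = c₆ })
    ... | true  | true  | true  | true  | b₅    | b₆    | _ | _ | _ | _ | _ | _ | _ | _ = inj₁ (s≤s (s≤s (s≤s (s≤s z≤n))))
    ... | true  | true  | true  | false | true  | b₆    | _ | _ | _ | _ | _ | _ | _ | _ = inj₁ (s≤s (s≤s (s≤s (s≤s z≤n))))
    ... | true  | true  | false | true  | true  | b₆    | _ | _ | _ | _ | _ | _ | _ | _ = inj₁ (s≤s (s≤s (s≤s (s≤s z≤n))))
    ... | true  | false | true  | true  | true  | b₆    | _ | _ | _ | _ | _ | _ | _ | _ = inj₁ (s≤s (s≤s (s≤s (s≤s z≤n))))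
    ... | true  | false | true  | true  | false | true  | _ | _ | _ | _ | _ | _ | _ | _ = inj₁ (s≤s (s≤s (s≤s (s≤s z≤n))))
    ... | true  | false | true  | false | true  | true  | _ | _ | _ | _ | _ | _ | _ | _ = inj₁ (s≤s (s≤s (s≤s (s≤s z≤n))))
    ... | false | true  | true  | true  | true  | b₆    | _ | _ | _ | _ | _ | _ | _ | _ = inj₁ (s≤s (s≤s (s≤s (s≤s z≤n))))
    ... | false | true  | true  | true  | false | true  | _ | _ | _ | _ | _ | _ | _ | _ = inj₁ (s≤s (s≤s (s≤s (s≤s z≤n))))
    ... | false | true  | false | true  | true  | true  | _ | _ | _ | _ | _ | _ | _ | _ = inj₁ (s≤s (s≤s (s≤s (s≤s z≤n))))
    ... | _ | false | false | _ | _ | _ | _ | () | _ | _ | _ | _ | _ | _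
    ... | _ | _ | false | false | _ | _ | _ | _ | () | _ | _ | _ | _ | _
    ... | _ | _ | false | true | false | _ | _ | _ | _ | () | _ | _ | _ | _
    ... | _ | _ | false | true | true | false | _ | _ | _ | _ | () | _ | _ | _
    ... | true | true | true | false | false | _ | _ | _ | _ | _ | _ | _ | () | _
    ... | true | false | true | false | false | _ | _ | _ | _ | _ | _ | _ | () | _
    ... | true | false | true | true | false | false | _ | _ | _ | _ | _ | _ | _ | ()
    ... | false | true | true | true | false | false | _ | _ | _ | _ | _ | _ | _ | ()
    ... | false | true | true | false | _ | _ | _ | _ | _ | _ | _ | () | _ | _
    ... | false | false | _ | _ | _ | _ | () | _ | _ | _ | _ | _ | _ | _

    tight-count : ∀ {C i} → Tight C i → guardCount C i ≡ 3
    tight-count t rewrite Tight.a₁∈ t | Tight.a₂∉ t | Tight.a₃∈ t | Tight.a₄∉ t | Tight.a₅∈ t | Tight.a₆∉ t = refl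

    3≤guardCount : ∀ {C} → Covers C → ∀ i → 3 ≤ guardCount C i
    3≤guardCount cov i with gadget-cases cov i
    ... | inj₁ h = ℕ.≤-trans (ℕ.n≤1+n 3) h
    ... | inj₂ t = ℕ.≤-reflexive (sym (tight-count t))

    module _ {C C′ : V → Bool} {φ : V → V} (d : Defence C C′ φ) where
      open Flow d

      private
        1≤flow : ∀ {u v} → moves u v ≡ true → 1 ≤ flow u v
        1≤flow m rewrite m = s≤s z≤n

        empty : ∀ {u v} → C u ≡ false → moves u v ≢ true
        empty c m with trans (sym c) (proj₁ (moves⇒ m))
        ... | ()

        flow≡0 : ∀ {u v} → C u ≡ false → flow u v ≡ 0
        flow≡0 c rewrite c = refl

      -- In the doubly tight case nothing leaves through a₂, which was empty. If the guard of a₁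
      -- leaves to the left, a₁ must be refilled; its neighbours a₂ and a₄ were empty, so the new
      -- guard comes through the same boundary edge.
      wall : Covers C → Covers C′ → ∀ i → 7 ≤ guardCount C i + guardCount C′ i ⊎ outˡ i ≤ inˡ i
      wall cov cov′ i with gadget-cases cov i | gadget-cases cov′ i
      ... | inj₁ h | _      = inj₁ (ℕ.+-mono-≤ h (3≤guardCount cov′ i))
      ... | inj₂ t | inj₁ h = inj₁ (ℕ.+-mono-≤ (3≤guardCount cov i) h)
      ... | inj₂ t | inj₂ t′ = inj₂ (ℕ.+-mono-≤ (bit≤ swapped)
                                 (ℕ.≤-trans (ℕ.≤-reflexive (flow≡0 (Tight.a₂∉ t))) z≤n))
        where
        swapped : moves (a₁ i) (prevBottom i) ≡ true → 1 ≤ flow (prevBottom i) (a₁ i)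
        swapped m with origin (Tight.a₁∈ t′)
        ... | u , m′ , inj₁ refl = ⊥-elim (prevBottom-outside i 0F (trans (sym (proj₂ (moves⇒ m))) (proj₂ (moves⇒ m′))))
        ... | u , m′ , inj₂ (inj₁ ya)      = 1≤flow m′
        ... | u , m′ , inj₂ (inj₁ (l61 j)) = 1≤flow m′
        ... | u , m′ , inj₂ (inj₂ (e12 _)) = ⊥-elim (empty (Tight.a₂∉ t) m′)
        ... | u , m′ , inj₂ (inj₂ (e14 _)) = ⊥-elim (empty (Tight.a₄∉ t) m′)

      -- Two of a₃, a₅, a₆ are guarded afterwards, and apart from the guard of a₃
      -- only guards of the next gadget can get there.
      influx : Covers C′ → ∀ {i} → Tight C i → φ (a₅ i) ≡ a₄ i → outʳ i + 1 ≤ inʳ i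
      influx cov′ {i} t φa₅ = subst (λ f → flow (a₃ i) (nextTop i) + f + 1 ≤ inʳ i) (sym (flow≡0 (Tight.a₆∉ t)))
        (≤-by-difference 0
          (ℕ.+-mono-≤ (ℕ.≤-trans (two-of-three (C′ (a₃ i)) (C′ (a₅ i)) (C′ (a₆ i)) (meets cov′ (e35 i)) (meets cov′ (e36 i)) (meets cov′ (e56 i)))
                         (ℕ.+-mono-≤ (bit≤ into₃) (ℕ.+-mono-≤ (bit≤ into₅) (bit≤ into₆))))
                       -- Including `nextTop` among the destinations makes the estimate one of net
                       -- flow: if the guard of a₃ leaves to the right, it fills none of a₃, a₅, a₆.
                       (flow-out≤1 (a₃ i) {nextTop i ∷ a₃ i ∷ a₅ i ∷ a₆ i ∷ []}
                         ((o 2F ∷ o 4F ∷ o 5F ∷ []) ∷ ((λ ()) ∷ (λ ()) ∷ []) ∷ ((λ ()) ∷ []) ∷ [] ∷ [])))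
          (identity (flow (a₃ i) (nextTop i)) (flow (a₃ i) (a₃ i)) (flow (a₃ i) (a₅ i)) (flow (a₃ i) (a₆ i))
                    (flow (nextTop i) (a₃ i)) (flow (nextBottom i) (a₆ i))))
        where
        o = nextTop-outside i
        gone : ∀ {v} → v ≢ a₄ i → moves (a₅ i) v ≢ true
        gone v≢ m = v≢ (trans (sym (proj₂ (moves⇒ m))) φa₅)
        into₃ : C′ (a₃ i) ≡ true → 1 ≤ flow (a₃ i) (a₃ i) + flow (nextTop i) (a₃ i)
        into₃ c′ with origin c′
        ... | u , m , inj₁ refl            = ℕ.≤-trans (1≤flow m) (ℕ.m≤m+n _ _)
        ... | u , m , inj₂ (inj₁ (e23 _)) = ⊥-elim (empty (Tight.a₂∉ t) m)
        ... | u , m , inj₂ (inj₂ (e34 _)) = ⊥-elim (empty (Tight.a₄∉ t) m)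
        ... | u , m , inj₂ (inj₂ (e35 _)) = ⊥-elim (gone (λ ()) m)
        ... | u , m , inj₂ (inj₂ (e36 _)) = ⊥-elim (empty (Tight.a₆∉ t) m)
        ... | u , m , inj₂ (inj₂ (l32 j)) rewrite nextTop-inject₁ j = ℕ.≤-trans (1≤flow m) (ℕ.m≤n+m _ _)
        into₅ : C′ (a₅ i) ≡ true → 1 ≤ flow (a₃ i) (a₅ i)
        into₅ c′ with origin c′
        ... | u , m , inj₁ refl            = ⊥-elim (gone (λ ()) m)
        ... | u , m , inj₂ (inj₁ (e35 _)) = 1≤flow m
        ... | u , m , inj₂ (inj₁ (e45 _)) = ⊥-elim (empty (Tight.a₄∉ t) m)
        ... | u , m , inj₂ (inj₂ (e56 _)) = ⊥-elim (empty (Tight.a₆∉ t) m)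
        into₆ : C′ (a₆ i) ≡ true → 1 ≤ flow (a₃ i) (a₆ i) + flow (nextBottom i) (a₆ i)
        into₆ c′ with origin c′
        ... | u , m , inj₁ refl            = ⊥-elim (empty (Tight.a₆∉ t) m)
        ... | u , m , inj₂ (inj₁ (e36 _)) = ℕ.≤-trans (1≤flow m) (ℕ.m≤m+n _ _)
        ... | u , m , inj₂ (inj₁ (e56 _)) = ⊥-elim (gone (λ ()) m)
        ... | u , m , inj₂ (inj₂ ax) rewrite nextBottom-fromℕ {k} = ℕ.≤-trans (1≤flow m) (ℕ.m≤n+m _ _)
        ... | u , m , inj₂ (inj₂ (l61 j)) rewrite nextBottom-inject₁ j = ℕ.≤-trans (1≤flow m) (ℕ.m≤n+m _ _)
        identity : ∀ q s f g p r → q + 0 + 1 + ((s + p) + (f + (g + r)) + 1) + 0 ≡ p + r + (2 + (q + (s + (f + (g + 0)))))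
        identity = solve-∀

      move : Covers C → Covers C′ → Move (guardCount C)
      move cov cov′ = record
        { n′        = guardCount C′
        ; inˡ       = inˡ
        ; outˡ      = outˡ
        ; inʳ       = inʳ
        ; outʳ      = outʳ
        ; conserved = conserved
        ; link-in   = λ j → trans (ℕ.+-comm (flow (a₆ (inject₁ j)) (a₁ (suc j))) _)
            (cong₂ (λ p q → flow (a₃ (inject₁ j)) p + flow (a₆ (inject₁ j)) q) (sym (nextTop-inject₁ j)) (sym (nextBottom-inject₁ j)))
        ; link-out  = λ j → trans (ℕ.+-comm (flow (a₁ (suc j)) (a₆ (inject₁ j))) _)
            (cong₂ (λ p q → flow p (a₃ (inject₁ j)) + flow q (a₆ (inject₁ j))) (sym (nextTop-inject₁ j)) (sym (nextBottom-inject₁ j)))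
        ; end       = end
        ; wall      = wall cov cov′
        }
        where
        -- Both right-hand outer neighbours of the last gadget are `xᵥ`, so the whole inflow is the
        -- single guard of x.
        end : inʳ (fromℕ k) ≤ 1
        end rewrite nextTop-fromℕ {k} | nextBottom-fromℕ {k} =
          subst (λ z → flow xᵥ (a₃ (fromℕ k)) + z ≤ 1) (ℕ.+-identityʳ _)
            (flow-out≤1 xᵥ {a₃ (fromℕ k) ∷ a₆ (fromℕ k) ∷ []} (((λ ()) ∷ []) ∷ [] ∷ []))

    card : (C : Subset (3 + suc k * 6)) → let g = guards {k} C in
           ∣ C ∣ ≡ bit (g xᵥ) + (bit (g yᵥ) + (bit (g zᵥ) + sum (guardCount g)))
    card C = trans (∣∣≡∑ C) (∑-vertices {k} (bit ∘ lookup C))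

    eternal-bound : ∀ {s} → HasEternalClass (G (suc k)) s → 7 * suc k + 2 ≤ 2 * s
    eternal-bound {s} (𝒞 , cls) = bound
      where
      open IsEternalClass cls
      C₀ = proj₁ nonempty
      C₀∈ = proj₂ nonempty
      C : V → Bool
      C = guards C₀
      cov : Covers C
      cov = covers (cover C₀ C₀∈)
      forcing : ∀ i → Tight C i → Forcing (guardCount C) i
      forcing i t with defend C₀ C₀∈ (vertex (a₄ i)) (vertex (a₅ i)) (vertex-adj (inj₁ (e45 i)))
      ... | C₁ , C₁∈ , φ , d = move D cov cov₁ , influx D cov₁ t (moved (IsDefence.crosses d))
        where
        D = defence d
        cov₁ = covers (cover C₁ C₁∈)
        moved : (vertex (a₄ i) ∈ C₀ × φ (vertex (a₄ i)) ≡ vertex (a₅ i)) ⊎ (vertex (a₅ i) ∈ C₀ × φ (vertex (a₅ i)) ≡ vertex (a₄ i)) →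
                label (φ (vertex (a₅ i))) ≡ a₄ i
        moved (inj₁ (a₄∈ , _)) with () ← trans (sym ([]=⇒lookup a₄∈)) (Tight.a₄∉ t)
        moved (inj₂ (_ , e)) = trans (cong label e) (label-vertex _)
      cases : ∀ i → 4 ≤ guardCount C i ⊎ (3 ≤ guardCount C i × Forcing (guardCount C) i)
      cases i with gadget-cases cov i
      ... | inj₁ h = inj₁ h
      ... | inj₂ t = inj₂ (3≤guardCount cov i , forcing i t)
      bound : 7 * suc k + 2 ≤ 2 * s
      bound = subst (λ s → 7 * suc k + 2 ≤ 2 * s) (trans (sym (card C₀)) (size C₀ C₀∈))
        -- Doubled, the gadgets hold at least 7r - 1 guards and the triangle at least 4: one more
        -- than 7r + 2.
        (≤-by-difference 1
          (ℕ.+-mono-≤ (dense (denseSuffixes cases)) (ℕ.*-monoʳ-≤ 2 (two-of-three (C xᵥ) (C yᵥ) (C zᵥ) (meets cov xy) (meets cov xz) (meets cov yz))))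
          (identity (bit (C xᵥ)) (bit (C yᵥ)) (bit (C zᵥ)) (sum (guardCount C)) (7 * suc k)))
        where
        identity : ∀ x y z s m → m + 2 + (2 * s + 1 + 2 * (x + (y + z))) + 1 ≡ 2 * (x + (y + (z + s))) + (m + 4)
        identity = solve-∀

  -- A small vertex cover.

  module _ (k : ℕ) where

    -- The tight pattern in every gadget covers all links. The unguarded first a₂ and last a₆ then
    -- force z and x, and these two also cover the triangle.
    smallCover : Vertex (suc k) → Bool
    smallCover xᵥ     = true
    smallCover yᵥ     = false
    smallCover zᵥ     = true
    smallCover (a₁ i) = true
    smallCover (a₂ i) = false
    smallCover (a₃ i) = true
    smallCover (a₄ i) = false
    smallCover (a₅ i) = true
    smallCover (a₆ i) = false

    private
      S : Subset (3 + suc k * 6)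
      S = tabulate (smallCover ∘ label)

      member : ∀ u → smallCover (label u) ≡ true → u ∈ S
      member u h = lookup⇒[]= u S (trans (lookup∘tabulate (smallCover ∘ label) u) h)

      meets-edge : ∀ {u v : Vertex (suc k)} → Edge u v → smallCover u ≡ true ⊎ smallCover v ≡ true
      meets-edge xy      = inj₁ refl
      meets-edge xz      = inj₁ refl
      meets-edge yz      = inj₂ refl
      meets-edge za      = inj₁ refl
      meets-edge ya      = inj₂ refl
      meets-edge ax      = inj₂ refl
      meets-edge (e12 i) = inj₁ refl
      meets-edge (e23 i) = inj₂ refl
      meets-edge (e34 i) = inj₁ refl
      meets-edge (e35 i) = inj₁ refl
      meets-edge (e36 i) = inj₁ refl
      meets-edge (e14 i) = inj₁ refl
      meets-edge (e45 i) = inj₂ refl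
      meets-edge (e56 i) = inj₁ refl
      meets-edge (l32 j) = inj₁ refl
      meets-edge (l61 j) = inj₂ refl

      covering : VertexCover (G (suc k)) S
      covering u v a = cover (adj⇒ u v a)
        where
        cover : Adjacent (label u) (label v) → u ∈ S ⊎ v ∈ S
        cover (inj₁ e) = [ inj₁ ∘ member u , inj₂ ∘ member v ]′ (meets-edge e)
        cover (inj₂ e) = [ inj₂ ∘ member v , inj₁ ∘ member u ]′ (meets-edge e)

      guards≗ : ∀ v → guards S v ≡ smallCover v
      guards≗ v = trans (lookup∘tabulate (smallCover ∘ label) (vertex v)) (cong smallCover (label-vertex v))

      ∑-const : ∀ n c → sum (λ (_ : Fin n) → c) ≡ n * c
      ∑-const zero    c = refl
      ∑-const (suc n) c = cong (λ s → c + s) (∑-const n c)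

      size : ∣ S ∣ ≡ 3 * suc k + 2
      size = begin
        ∣ S ∣
          ≡⟨ card {k} S ⟩
        bit (guards {k} S xᵥ) + (bit (guards {k} S yᵥ) + (bit (guards {k} S zᵥ) + sum (guardCount (guards {k} S))))
          ≡⟨ cong₂ _+_ (bit≗ xᵥ) (cong₂ _+_ (bit≗ yᵥ) (cong₂ _+_ (bit≗ zᵥ) (sum-cong-≗ λ i → sum-cong-≗ λ t → bit≗ (inj₂ (i , t))))) ⟩
        1 + (0 + (1 + sum (λ (i : Fin (suc k)) → 3)))
          ≡⟨ cong (λ s → 2 + s) (trans (∑-const (suc k) 3) (ℕ.*-comm (suc k) 3)) ⟩
        2 + 3 * suc k
          ≡⟨ ℕ.+-comm 2 _ ⟩
        3 * suc k + 2 ∎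
        where
        open ≡-Reasoning
        bit≗ : ∀ v → bit (guards S v) ≡ bit (smallCover v)
        bit≗ v = cong bit (guards≗ v)

    mvc-upper : mvc (G (suc k)) ≤ 3 * suc k + 2
    mvc-upper = IsMinimum.least (proj₂ (mvc-exists (G (suc k)))) (S , covering , size)

    mvc-nonZero : NonZero (mvc (G (suc k)))
    mvc-nonZero with IsMinimum.holds (proj₂ (mvc-exists (G (suc k))))
    ... | C , cov , size = >-nonZero (subst (0 ℕ.<_) size (positive (cov (vertex {k} xᵥ) (vertex {k} yᵥ) (vertex-adj {k} {xᵥ} {yᵥ} (inj₁ xy)))))
      where
      positive : ∀ {u v} → u ∈ C ⊎ v ∈ C → 0 ℕ.< ∣ C ∣
      positive (inj₁ u∈) = ℕ.≤-<-trans z≤n (x∈p⇒∣p-x∣<∣p∣ u∈)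
      positive (inj₂ v∈) = ℕ.≤-<-trans z≤n (x∈p⇒∣p-x∣<∣p∣ v∈)

    evc-lower : 7 * suc k + 2 ≤ 2 * evc (G (suc k))
    evc-lower = eternal-bound (IsMinimum.holds (proj₂ (evc-exists (G (suc k)))))

-- Rooted trees, degrees and rotations in general.

module HalinEmbedding where

  open Counting
  open import Data.Fin.Subset using (_-_)
  open import Data.Nat using (_+_; _*_; _≤_; _<_)
  open import Relation.Binary.Construct.Closure.ReflexiveTransitive using (Star; ε; _◅_; _◅◅_; reverse)

  argmax : ∀ {l} (f : Fin (suc l) → ℕ) → ∃[ m ] ∀ j → f j ≤ f m
  argmax {zero}  f = zero , λ { zero → ℕ.≤-refl }
  argmax {suc l} f with argmax (f ∘ suc)
  ... | m , max with ℕ.≤-total (f zero) (f (suc m))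
  ...   | inj₁ h = suc m , λ { zero → h ; (suc j) → max j }
  ...   | inj₂ h = zero , λ { zero → ℕ.≤-refl ; (suc j) → ℕ.≤-trans (max j) h }

  -- A depth that strictly decreases towards the root yields both tree axioms: following parents
  -- terminates at the root, and a cycle has a deepest vertex.
  module ParentTree {n} (root : Fin n) (parent : Fin n → Fin n) (depth : Fin n → ℕ)
                    (descends : ∀ v → v ≢ root → depth (parent v) < depth v) where

    HasParent : Fin n → Fin n → Set
    HasParent v w = v ≢ root × parent v ≡ w

    hasParent? : ∀ v w → Dec (HasParent v w)
    hasParent? v w = ¬? (v Fin.≟ root) ×-dec (parent v Fin.≟ w)

    loopless : ∀ {v} → ¬ HasParent v v
    loopless {v} (v≢root , e) = ℕ.<-irrefl (cong depth e) (descends v v≢root)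

    tree : Graph n
    tree = record
      { Adj    = λ v w → HasParent v w ⊎ HasParent w v
      ; adj?   = λ v w → hasParent? v w ⊎-dec hasParent? w v
      ; symm   = swap
      ; irrefl = λ { refl → [ loopless , loopless ]′ }
      }

    toRoot : ∀ d v → depth v ≤ d → Star (Adj tree) v root
    toRoot d v h with v Fin.≟ root
    ... | yes refl  = ε
    ... | no v≢root with d | ℕ.≤-trans (descends v v≢root) h
    ...   | suc d | s≤s h′ = inj₁ (v≢root , refl) ◅ toRoot d (parent v) h′

    -- A deepest vertex of a cycle would have its parent as both neighbours.
    acyclic : ¬ Cycle tree
    acyclic c = twoNeighbours m deepest
      where
      open Cycle c renaming (vertex to corner)
      m = proj₁ (argmax (depth ∘ corner))
      deepest = proj₂ (argmax (depth ∘ corner))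
      Deepest : Fin (3 + l) → Set
      Deepest m = ∀ j → depth (corner j) ≤ depth (corner m)
      neighbour : ∀ {m} → Deepest m → ∀ {j} → Adj tree (corner m) (corner j) → parent (corner m) ≡ corner j
      neighbour d (inj₁ (_ , e)) = e
      neighbour d {j} (inj₂ (j≢root , e)) =
        ⊥-elim (ℕ.<⇒≱ (subst (λ v → depth v < depth (corner j)) e (descends _ j≢root)) (d j))
      same : ∀ {m} → Deepest m → ∀ {i j} → Adj tree (corner m) (corner i) → Adj tree (corner m) (corner j) → i ≡ j
      same d a b = injective (trans (sym (neighbour d a)) (neighbour d b))
      -- The deepest corner is the first, the last or an interior one; the closing edge takes part
      -- in the first two cases.
      twoNeighbours : ∀ m → ¬ Deepest m
      twoNeighbours zero d with () ← same d {suc zero} {fromℕ (2 + l)} (edges zero) (swap closing)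
      twoNeighbours (suc i) d with view i
      ... | ‵fromℕ with () ← same d {inject₁ i} {zero} (swap (edges i)) closing
      ... | ‵inject₁ i′ = distinct (same d {inject₁ i} {suc (suc i′)} (swap (edges i)) (edges (suc i′)))
        where
        distinct : inject₁ (inject₁ i′) ≢ suc (suc i′)
        distinct e = ℕ.<⇒≢ (ℕ.m≤n⇒m≤1+n ℕ.≤-refl) (begin
          toℕ i′                      ≡⟨ trans (sym (Fin.toℕ-inject₁ i′)) (sym (Fin.toℕ-inject₁ (inject₁ i′))) ⟩
          toℕ (inject₁ (inject₁ i′))  ≡⟨ cong toℕ e ⟩
          suc (suc (toℕ i′))          ∎)
          where open ≡-Reasoning

    isTree : IsTree tree
    isTree = record
      { connected = λ u v → toRoot _ u ℕ.≤-refl ◅◅ reverse swap (toRoot _ v ℕ.≤-refl)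
      ; acyclic   = acyclic
      }

  length≤card : ∀ {n} {L : List (Fin n)} {S : Subset n} → Unique L → All (_∈ S) L → length L ≤ ∣ S ∣
  length≤card []         []         = z≤n
  length≤card (x∉ ∷ uniq) (x∈ ∷ L⊆) =
    ℕ.≤-<-trans (length≤card uniq (All.zipWith (λ (x≢ , y∈) → x∈p∧x≢y⇒x∈p-y y∈ (x≢ ∘ sym)) (x∉ , L⊆))) (x∈p⇒∣p-x∣<∣p∣ x∈)

  card-remove : ∀ {n} (p : Subset n) x → ∣ p ∣ ≤ suc ∣ p - x ∣
  card-remove (true  ∷ p) zero    = s≤s (ℕ.≤-reflexive (cong ∣_∣ (sym (p─⊥≡p p))))
  card-remove (false ∷ p) zero    = ℕ.m≤n⇒m≤1+n (ℕ.≤-reflexive (cong ∣_∣ (sym (p─⊥≡p p))))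
  card-remove (true  ∷ p) (suc x) = s≤s (card-remove p x)
  card-remove (false ∷ p) (suc x) = card-remove p x

  x∉p-x : ∀ {n} (p : Subset n) x → ¬ x ∈ p - x
  x∉p-x (_     ∷ p) zero    ()
  x∉p-x (true  ∷ p) (suc x) (there x∈) = x∉p-x p x x∈
  x∉p-x (false ∷ p) (suc x) (there x∈) = x∉p-x p x x∈

  card≤length : ∀ {n} (L : List (Fin n)) {S : Subset n} → (∀ {x} → x ∈ S → x ∈ˡ L) → ∣ S ∣ ≤ length L
  card≤length {n} [] {S} S⊆ = ℕ.≤-trans (p⊆q⇒∣p∣≤∣q∣ {p = S} {q = ⊥} (λ x∈ → ⊥-elim (¬Any[] (S⊆ x∈)))) (ℕ.≤-reflexive (∣⊥∣≡0 n))
  card≤length (y ∷ L) {S} S⊆ = ℕ.≤-trans (card-remove S y) (s≤s (card≤length L rest))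
    where
    rest : ∀ {x} → x ∈ S - y → x ∈ˡ L
    rest x∈ with S⊆ (p─q⊆p S ⁅ y ⁆ x∈)
    ... | there x∈L = x∈L
    ... | here refl = ⊥-elim (x∉p-x S y x∈)

  degree≡length : ∀ {n} (Γ : Graph n) v (L : List (Fin n)) → Unique L →
                  (∀ w → Adj Γ v w → w ∈ˡ L) → (∀ w → w ∈ˡ L → Adj Γ v w) → degree Γ v ≡ length L
  degree≡length Γ v L uniq ⊆L L⊆ = ℕ.≤-antisym
    (card≤length L {neighbours Γ v} λ {w} w∈ → ⊆L w (adjacent w (trans (sym (lookup-neighbours w)) ([]=⇒lookup w∈))))
    (length≤card {S = neighbours Γ v} uniq
      (All.tabulate λ {w} w∈ → lookup⇒[]= w _ (trans (lookup-neighbours w) (dec-true (adj? Γ v w) (L⊆ w w∈)))))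
    where
    lookup-neighbours : ∀ w → lookup (neighbours Γ v) w ≡ does (adj? Γ v w)
    lookup-neighbours = lookup∘tabulate (does ∘ adj? Γ v)
    adjacent : ∀ w → does (adj? Γ v w) ≡ true → Adj Γ v w
    adjacent w e with adj? Γ v w
    ... | yes a = a

  -- Chain f a L b: iterating f from a runs through the elements of L and then reaches b.
  data Chain {A : Set} (f : A → A) : A → List A → A → Set where
    [_] : ∀ {a b} → f a ≡ b → Chain f a [] b
    _∷_ : ∀ {a b c L} → f a ≡ c → Chain f c L b → Chain f a (c ∷ L) b

  module _ {A : Set} {f : A → A} where

    Reaches : A → A → Set
    Reaches a b = ∃[ k ] iterate f a k ≡ b

    reaches-step : ∀ {a b} → Reaches (f a) b → Reaches a b
    reaches-step (k , e) = suc k , e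

    reaches-trans : ∀ {a b c} → Reaches a b → Reaches b c → Reaches a c
    reaches-trans (zero  , refl) r = r
    reaches-trans (suc k , e)    r = reaches-step (reaches-trans (k , e) r)

    chain-from : ∀ {a L b w} → Chain f a L b → w ∈ˡ a ∷ L → Reaches a w
    chain-from c          (here refl) = 0 , refl
    chain-from (refl ∷ c) (there w∈)  = reaches-step (chain-from c w∈)

    chain-to : ∀ {a L b w} → Chain f a L b → w ∈ˡ a ∷ L → Reaches w b
    chain-to [ e ]      (here refl) = 1 , e
    chain-to (refl ∷ c) (here refl) = reaches-step (chain-to c (here refl))
    chain-to (refl ∷ c) (there w∈)  = chain-to c w∈

    -- Running from `w` to the end of the closed chain and on from its start to `w′` avoids
    -- comparing the positions of the two.
    chain-orbit : ∀ {a L w w′} → Chain f a L a → w ∈ˡ a ∷ L → w′ ∈ˡ a ∷ L → Reaches w w′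
    chain-orbit c w∈ w′∈ = reaches-trans (chain-to c w∈) (chain-from c w′∈)

    chain-image : ∀ {a L b w} → Chain f a L b → w ∈ˡ a ∷ L → f w ≡ b ⊎ f w ∈ˡ L
    chain-image [ e ]      (here refl) = inj₁ e
    chain-image (e ∷ c)    (here refl) = inj₂ (here e)
    chain-image (refl ∷ c) (there w∈)  = map₂ there (chain-image c w∈)

    chain-closed : ∀ {a L w} → Chain f a L a → w ∈ˡ a ∷ L → f w ∈ˡ a ∷ L
    chain-closed c w∈ = [ here , there ]′ (chain-image c w∈)

  module _ {n} {Γ : Graph n} (π : PlaneEmbedding Γ) where

    -- The boundary walk is deterministic, so one exhibited walk determines the first leaf met from
    -- its starting step.
    reachesLeaf-unique : ∀ {u v ℓ ℓ′} → ReachesLeaf π u v ℓ → ReachesLeaf π u v ℓ′ → ℓ ≡ ℓ′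
    reachesLeaf-unique (arrive _)    (arrive _)    = refl
    reachesLeaf-unique (arrive leaf) (turn ¬leaf _) = ⊥-elim (¬leaf leaf)
    reachesLeaf-unique (turn ¬leaf _) (arrive leaf) = ⊥-elim (¬leaf leaf)
    reachesLeaf-unique (turn _ r)    (turn _ r′)   = reachesLeaf-unique r r′

  -- The graph as a Halin graph.

  module _ {k : ℕ} where

    private
      V : Set
      V = Vertex (suc k)

    -- The tree is a caterpillar rooted at z. Its spine runs from z through a₂ and a₃ of each gadget
    -- in turn; x, y and all a₁, a₄, a₅, a₆ are leaves attached to it.
    parent : V → V
    parent xᵥ     = zᵥ
    parent yᵥ     = zᵥ
    parent zᵥ     = zᵥ
    parent (a₁ i) = a₂ i
    parent (a₂ i) = prevTop i
    parent (a₃ i) = a₂ i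
    parent (a₄ i) = a₃ i
    parent (a₅ i) = a₃ i
    parent (a₆ i) = a₃ i

    depth : V → ℕ
    depth xᵥ     = 1
    depth yᵥ     = 1
    depth zᵥ     = 0
    depth (a₁ i) = 2 + 2 * toℕ i
    depth (a₂ i) = 1 + 2 * toℕ i
    depth (a₃ i) = 2 + 2 * toℕ i
    depth (a₄ i) = 3 + 2 * toℕ i
    depth (a₅ i) = 3 + 2 * toℕ i
    depth (a₆ i) = 3 + 2 * toℕ i

    parent-descends : ∀ v → v ≢ zᵥ → depth (parent v) < depth v
    parent-descends xᵥ _         = s≤s z≤n
    parent-descends yᵥ _         = s≤s z≤n
    parent-descends zᵥ z≢z       = ⊥-elim (z≢z refl)
    parent-descends (a₁ i) _     = ℕ.≤-refl
    parent-descends (a₂ zero) _  = s≤s z≤n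
    parent-descends (a₂ (suc j)) _ rewrite Fin.toℕ-inject₁ j | ℕ.*-suc 2 (toℕ j) = ℕ.≤-refl
    parent-descends (a₃ i) _     = ℕ.≤-refl
    parent-descends (a₄ i) _     = ℕ.≤-refl
    parent-descends (a₅ i) _     = ℕ.≤-refl
    parent-descends (a₆ i) _     = ℕ.≤-refl

    Up : V → V → Set
    Up u v = u ≢ zᵥ × parent u ≡ v

    Joined : V → V → Set
    Joined u v = Up u v ⊎ Up v u

    below : Fin (suc k) → List V
    below i with view i
    ... | ‵fromℕ     = []
    ... | ‵inject₁ j = a₂ (suc j) ∷ []

    below-inject₁ : ∀ j → below (inject₁ j) ≡ a₂ (suc j) ∷ []
    below-inject₁ j rewrite view-inject₁ j = refl

    below-fromℕ : below (fromℕ k) ≡ []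
    below-fromℕ rewrite view-fromℕ k = refl

    firstNeighbour : V → V
    firstNeighbour xᵥ     = zᵥ
    firstNeighbour yᵥ     = zᵥ
    firstNeighbour zᵥ     = xᵥ
    firstNeighbour (a₁ i) = a₂ i
    firstNeighbour (a₂ i) = prevTop i
    firstNeighbour (a₃ i) = a₂ i
    firstNeighbour (a₄ i) = a₃ i
    firstNeighbour (a₅ i) = a₃ i
    firstNeighbour (a₆ i) = a₃ i

    -- The order matters: after `firstNeighbour` the list gives the rotation around the vertex,
    -- arranged so that the leaves appear as x, y and then a₁, a₄, a₅, a₆ of each gadget. Leaves are
    -- the vertices with an empty list.
    otherNeighbours : V → List V
    otherNeighbours xᵥ     = []
    otherNeighbours yᵥ     = []
    otherNeighbours zᵥ     = yᵥ ∷ a₂ zero ∷ []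
    otherNeighbours (a₁ i) = []
    otherNeighbours (a₂ i) = a₁ i ∷ a₃ i ∷ []
    otherNeighbours (a₃ i) = a₄ i ∷ a₅ i ∷ a₆ i ∷ below i
    otherNeighbours (a₄ i) = []
    otherNeighbours (a₅ i) = []
    otherNeighbours (a₆ i) = []

    treeNeighbours : V → List V
    treeNeighbours v = firstNeighbour v ∷ otherNeighbours v

    treeNeighbours-unique : ∀ v → Unique (treeNeighbours v)
    treeNeighbours-unique xᵥ     = [] ∷ []
    treeNeighbours-unique yᵥ     = [] ∷ []
    treeNeighbours-unique zᵥ     = ((λ ()) ∷ (λ ()) ∷ []) ∷ ((λ ()) ∷ []) ∷ [] ∷ []
    treeNeighbours-unique (a₁ i) = [] ∷ []
    treeNeighbours-unique (a₂ i) =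
      (prevTop-outside i 0F ∷ prevTop-outside i 2F ∷ []) ∷ ((λ ()) ∷ []) ∷ [] ∷ []
    treeNeighbours-unique (a₃ i) with view i
    ... | ‵fromℕ = ((λ ()) ∷ (λ ()) ∷ (λ ()) ∷ []) ∷ ((λ ()) ∷ (λ ()) ∷ []) ∷ ((λ ()) ∷ []) ∷ [] ∷ []
    ... | ‵inject₁ j = ((λ ()) ∷ (λ ()) ∷ (λ ()) ∷ consecutive ∷ []) ∷ ((λ ()) ∷ (λ ()) ∷ (λ ()) ∷ []) ∷
                       ((λ ()) ∷ (λ ()) ∷ []) ∷ ((λ ()) ∷ []) ∷ [] ∷ []
    treeNeighbours-unique (a₄ i) = [] ∷ []
    treeNeighbours-unique (a₅ i) = [] ∷ []
    treeNeighbours-unique (a₆ i) = [] ∷ []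

    joined⇒∈ : ∀ {u v} → Joined u v → v ∈ˡ treeNeighbours u
    joined⇒∈ {xᵥ}   (inj₁ (_ , refl)) = here refl
    joined⇒∈ {yᵥ}   (inj₁ (_ , refl)) = here refl
    joined⇒∈ {zᵥ}   (inj₁ (z≢z , _))  = ⊥-elim (z≢z refl)
    joined⇒∈ {a₁ i} (inj₁ (_ , refl)) = here refl
    joined⇒∈ {a₂ i} (inj₁ (_ , refl)) = here refl
    joined⇒∈ {a₃ i} (inj₁ (_ , refl)) = here refl
    joined⇒∈ {a₄ i} (inj₁ (_ , refl)) = here refl
    joined⇒∈ {a₅ i} (inj₁ (_ , refl)) = here refl
    joined⇒∈ {a₆ i} (inj₁ (_ , refl)) = here refl
    joined⇒∈ {_} {xᵥ}   (inj₂ (_ , refl)) = here refl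
    joined⇒∈ {_} {yᵥ}   (inj₂ (_ , refl)) = there (here refl)
    joined⇒∈ {_} {zᵥ}   (inj₂ (z≢z , _))  = ⊥-elim (z≢z refl)
    joined⇒∈ {_} {a₁ i} (inj₂ (_ , refl)) = there (here refl)
    joined⇒∈ {_} {a₂ zero}    (inj₂ (_ , refl)) = there (there (here refl))
    joined⇒∈ {_} {a₂ (suc j)} (inj₂ (_ , refl)) rewrite below-inject₁ j = there (there (there (there (here refl))))
    joined⇒∈ {_} {a₃ i} (inj₂ (_ , refl)) = there (there (here refl))
    joined⇒∈ {_} {a₄ i} (inj₂ (_ , refl)) = there (here refl)
    joined⇒∈ {_} {a₅ i} (inj₂ (_ , refl)) = there (there (here refl))
    joined⇒∈ {_} {a₆ i} (inj₂ (_ , refl)) = there (there (there (here refl)))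

    ∈⇒joined : ∀ u {v} → v ∈ˡ treeNeighbours u → Joined u v
    ∈⇒joined xᵥ (here refl) = inj₁ ((λ ()) , refl)
    ∈⇒joined yᵥ (here refl) = inj₁ ((λ ()) , refl)
    ∈⇒joined zᵥ (here refl) = inj₂ ((λ ()) , refl)
    ∈⇒joined zᵥ (there (here refl)) = inj₂ ((λ ()) , refl)
    ∈⇒joined zᵥ (there (there (here refl))) = inj₂ ((λ ()) , refl)
    ∈⇒joined (a₁ i) (here refl) = inj₁ ((λ ()) , refl)
    ∈⇒joined (a₂ i) (here refl) = inj₁ ((λ ()) , refl)
    ∈⇒joined (a₂ i) (there (here refl)) = inj₂ ((λ ()) , refl)
    ∈⇒joined (a₂ i) (there (there (here refl))) = inj₂ ((λ ()) , refl)
    ∈⇒joined (a₃ i) (here refl) = inj₁ ((λ ()) , refl)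
    ∈⇒joined (a₃ i) (there (here refl)) = inj₂ ((λ ()) , refl)
    ∈⇒joined (a₃ i) (there (there (here refl))) = inj₂ ((λ ()) , refl)
    ∈⇒joined (a₃ i) (there (there (there (here refl)))) = inj₂ ((λ ()) , refl)
    ∈⇒joined (a₃ i) (there (there (there (there v∈)))) with view i
    ... | ‵inject₁ j with here refl ← v∈ = inj₂ ((λ ()) , refl)
    ∈⇒joined (a₄ i) (here refl) = inj₁ ((λ ()) , refl)
    ∈⇒joined (a₅ i) (here refl) = inj₁ ((λ ()) , refl)
    ∈⇒joined (a₆ i) (here refl) = inj₁ ((λ ()) , refl)

    afterA₆ : Fin (suc k) → V
    afterA₆ i with view i
    ... | ‵fromℕ     = a₂ i
    ... | ‵inject₁ j = a₂ (suc j)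

    -- turnAt v w is junk unless w is a neighbour of v, so the second clauses for a₂ and
    -- a₃ only have to tell a₃ i from prevTop i, and a₂ i from the a₂ of the next gadget.
    turnAt : V → V → V
    turnAt xᵥ _          = zᵥ
    turnAt yᵥ _          = zᵥ
    turnAt zᵥ xᵥ         = yᵥ
    turnAt zᵥ yᵥ         = a₂ zero
    turnAt zᵥ _          = xᵥ
    turnAt (a₁ i) _      = a₂ i
    turnAt (a₂ i) (a₁ _) = a₃ i
    turnAt (a₂ i) w      = if does (w ≟ⱽ a₃ i) then prevTop i else a₁ i
    turnAt (a₃ i) (a₄ _) = a₅ i
    turnAt (a₃ i) (a₅ _) = a₆ i
    turnAt (a₃ i) (a₆ _) = afterA₆ i
    turnAt (a₃ i) w      = if does (w ≟ⱽ a₂ i) then a₄ i else a₂ i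
    turnAt (a₄ i) _      = a₃ i
    turnAt (a₅ i) _      = a₃ i
    turnAt (a₆ i) _      = a₃ i

    turn-a₂-prev : ∀ i → turnAt (a₂ i) (prevTop i) ≡ a₁ i
    turn-a₂-prev zero    = refl
    turn-a₂-prev (suc j) rewrite dec-false (a₃ (inject₁ j) ≟ⱽ a₃ (suc j)) consecutive = refl

    turn-a₂-a₃ : ∀ i → turnAt (a₂ i) (a₃ i) ≡ prevTop i
    turn-a₂-a₃ i rewrite dec-true (a₃ i ≟ⱽ a₃ i) refl = refl

    turn-a₃-a₂ : ∀ i → turnAt (a₃ i) (a₂ i) ≡ a₄ i
    turn-a₃-a₂ i rewrite dec-true (a₂ i ≟ⱽ a₂ i) refl = refl

    turn-a₃-next : ∀ j → turnAt (a₃ (inject₁ j)) (a₂ (suc j)) ≡ a₂ (inject₁ j)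
    turn-a₃-next j rewrite dec-false (a₂ (suc j) ≟ⱽ a₂ (inject₁ j)) (consecutive ∘ sym) = refl

    afterA₆-inject₁ : ∀ j → afterA₆ (inject₁ j) ≡ a₂ (suc j)
    afterA₆-inject₁ j rewrite view-inject₁ j = refl

    afterA₆-fromℕ : afterA₆ (fromℕ k) ≡ a₂ (fromℕ k)
    afterA₆-fromℕ rewrite view-fromℕ k = refl

    turn-chain : ∀ v → Chain (turnAt v) (firstNeighbour v) (otherNeighbours v) (firstNeighbour v)
    turn-chain xᵥ     = [ refl ]
    turn-chain yᵥ     = [ refl ]
    turn-chain zᵥ     = refl ∷ refl ∷ [ refl ]
    turn-chain (a₁ i) = [ refl ]
    turn-chain (a₂ i) = turn-a₂-prev i ∷ refl ∷ [ turn-a₂-a₃ i ]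
    turn-chain (a₃ i) = turn-a₃-a₂ i ∷ refl ∷ refl ∷ last (view i)
      where
      last : View i → Chain (turnAt (a₃ i)) (a₆ i) (below i) (a₂ i)
      last ‵fromℕ       rewrite below-fromℕ = [ afterA₆-fromℕ ]
      last (‵inject₁ j) rewrite below-inject₁ j = afterA₆-inject₁ j ∷ [ turn-a₃-next j ]
    turn-chain (a₄ i) = [ refl ]
    turn-chain (a₅ i) = [ refl ]
    turn-chain (a₆ i) = [ refl ]

    -- Junk on the inner vertices of the tree.
    nextLeaf : V → V
    nextLeaf xᵥ     = yᵥ
    nextLeaf yᵥ     = a₁ zero
    nextLeaf zᵥ     = zᵥ
    nextLeaf (a₁ i) = a₄ i
    nextLeaf (a₂ i) = a₂ i
    nextLeaf (a₃ i) = a₃ i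
    nextLeaf (a₄ i) = a₅ i
    nextLeaf (a₅ i) = a₆ i
    nextLeaf (a₆ i) = nextBottom i

    IsLeaf : V → Set
    IsLeaf v = otherNeighbours v ≡ []

    Follows : V → V → Set
    Follows u v = IsLeaf u × nextLeaf u ≡ v

    edge⇒ : ∀ {u v} → Edge u v → Joined u v ⊎ Follows u v
    edge⇒ xy      = inj₂ (refl , refl)
    edge⇒ xz      = inj₁ (inj₁ ((λ ()) , refl))
    edge⇒ yz      = inj₁ (inj₁ ((λ ()) , refl))
    edge⇒ za      = inj₁ (inj₂ ((λ ()) , refl))
    edge⇒ ya      = inj₂ (refl , refl)
    edge⇒ ax      = inj₂ (refl , nextBottom-fromℕ)
    edge⇒ (e12 i) = inj₁ (inj₁ ((λ ()) , refl))
    edge⇒ (e23 i) = inj₁ (inj₂ ((λ ()) , refl))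
    edge⇒ (e34 i) = inj₁ (inj₂ ((λ ()) , refl))
    edge⇒ (e35 i) = inj₁ (inj₂ ((λ ()) , refl))
    edge⇒ (e36 i) = inj₁ (inj₂ ((λ ()) , refl))
    edge⇒ (e14 i) = inj₂ (refl , refl)
    edge⇒ (e45 i) = inj₂ (refl , refl)
    edge⇒ (e56 i) = inj₂ (refl , refl)
    edge⇒ (l32 j) = inj₁ (inj₂ ((λ ()) , refl))
    edge⇒ (l61 j) = inj₂ (refl , nextBottom-inject₁ j)

    up⇒ : ∀ {u v} → Up u v → Adjacent u v
    up⇒ {xᵥ}   (_ , refl) = inj₁ xz
    up⇒ {yᵥ}   (_ , refl) = inj₁ yz
    up⇒ {zᵥ}   (z≢z , _)  = ⊥-elim (z≢z refl)
    up⇒ {a₁ i} (_ , refl) = inj₁ (e12 i)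
    up⇒ {a₂ zero}    (_ , refl) = inj₂ za
    up⇒ {a₂ (suc j)} (_ , refl) = inj₂ (l32 j)
    up⇒ {a₃ i} (_ , refl) = inj₂ (e23 i)
    up⇒ {a₄ i} (_ , refl) = inj₂ (e34 i)
    up⇒ {a₅ i} (_ , refl) = inj₂ (e35 i)
    up⇒ {a₆ i} (_ , refl) = inj₂ (e36 i)

    follows⇒ : ∀ {u v} → Follows u v → Adjacent u v
    follows⇒ {xᵥ}   (_ , refl) = inj₁ xy
    follows⇒ {yᵥ}   (_ , refl) = inj₁ ya
    follows⇒ {zᵥ}   (() , _)
    follows⇒ {a₁ i} (_ , refl) = inj₁ (e14 i)
    follows⇒ {a₄ i} (_ , refl) = inj₁ (e45 i)
    follows⇒ {a₅ i} (_ , refl) = inj₁ (e56 i)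
    follows⇒ {a₆ i} (_ , refl) with view i
    ... | ‵fromℕ     = inj₁ ax
    ... | ‵inject₁ j = inj₁ (l61 j)

    private
      not-root : ∀ {u} → u ≢ vertex {k} zᵥ → label {k} u ≢ zᵥ
      not-root {u} u≢ e = u≢ (trans (sym (vertex-label u)) (cong vertex e))

    open module T = ParentTree (vertex {k} zᵥ) (λ u → vertex {k} (parent (label u))) (λ u → depth (label {k} u))
      (λ v v≢ → subst (λ p → depth p < depth (label v)) (sym (label-vertex (parent (label v)))) (parent-descends (label v) (not-root v≢)))
      using (tree)

    hasParent⇒up : ∀ {u v} → T.HasParent u v → Up (label u) (label v)
    hasParent⇒up (u≢ , e) = not-root u≢ , trans (sym (label-vertex _)) (cong label e)

    up⇒hasParent : ∀ {u v} → Up (label u) (label v) → T.HasParent u v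
    up⇒hasParent {u} {v} (u≢ , e) = (λ { refl → u≢ (label-vertex zᵥ) }) , trans (cong vertex e) (vertex-label v)

    tree⇒joined : ∀ u v → Adj tree u v → Joined (label u) (label v)
    tree⇒joined u v = [ inj₁ ∘ hasParent⇒up , inj₂ ∘ hasParent⇒up ]′

    joined⇒tree : ∀ u v → Joined (label u) (label v) → Adj tree u v
    joined⇒tree u v = [ inj₁ ∘ up⇒hasParent , inj₂ ∘ up⇒hasParent ]′

    tree-degree : ∀ u → degree tree u ≡ length (treeNeighbours (label u))
    tree-degree u = trans
      (degree≡length tree u (map vertex (treeNeighbours (label u)))
        (Unique.map⁺ vertex-injective (treeNeighbours-unique (label u)))
        (λ w a → subst (_∈ˡ map vertex (treeNeighbours (label u))) (vertex-label w) (∈-map⁺ vertex (joined⇒∈ (tree⇒joined u w a))))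
        (λ w w∈ → let (v , v∈ , e) = ∈-map⁻ vertex w∈ in
          joined⇒tree u w (subst (Joined (label u)) (sym (trans (cong label e) (label-vertex v))) (∈⇒joined (label u) v∈))))
      (length-map vertex (treeNeighbours (label u)))

    length≢2 : ∀ v → length (treeNeighbours v) ≢ 2
    length≢2 xᵥ     ()
    length≢2 yᵥ     ()
    length≢2 zᵥ     ()
    length≢2 (a₁ i) ()
    length≢2 (a₂ i) ()
    length≢2 (a₃ i) ()
    length≢2 (a₄ i) ()
    length≢2 (a₅ i) ()
    length≢2 (a₆ i) ()

    leaf⇒ : ∀ u → Leaf tree u → IsLeaf (label u)
    leaf⇒ u h = empty (otherNeighbours (label u)) (ℕ.suc-injective (trans (sym (tree-degree u)) h))
      where
      empty : ∀ (L : List V) → length L ≡ 0 → L ≡ []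
      empty [] _ = refl

    leaf⇐ : ∀ u → IsLeaf (label u) → Leaf tree u
    leaf⇐ u h = trans (tree-degree u) (cong (suc ∘ length) h)

    leaf-vertex : ∀ {v} → IsLeaf v → Leaf tree (vertex v)
    leaf-vertex {v} h = leaf⇐ (vertex v) (subst IsLeaf (sym (label-vertex v)) h)

    iterate-label : ∀ u w n → iterate (λ w → vertex (turnAt (label u) (label w))) w n ≡
                              vertex (iterate (turnAt (label u)) (label w) n)
    iterate-label u w zero    = sym (vertex-label w)
    iterate-label u w (suc n) = trans (iterate-label u (vertex (turnAt (label u) (label w))) n)
      (cong (λ x → vertex (iterate (turnAt (label u)) x n)) (label-vertex _))

    embedding : PlaneEmbedding tree
    embedding = record
      { rotate   = λ u w → vertex (turnAt (label u) (label w))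
      ; adjacent = λ u w a → joined⇒tree u (vertex (turnAt (label u) (label w)))
          (subst (Joined (label u)) (sym (label-vertex _))
            (∈⇒joined (label u) (chain-closed (turn-chain (label u)) (joined⇒∈ (tree⇒joined u w a)))))
      ; oneOrbit = λ u w w′ a a′ →
          let (n , e) = chain-orbit (turn-chain (label u)) (joined⇒∈ (tree⇒joined u w a)) (joined⇒∈ (tree⇒joined u w′ a′))
          in n , trans (iterate-label u w n) (trans (cong vertex e) (vertex-label w′))
      }

    Face : V → V → V → Set
    Face u v ℓ = ReachesLeaf embedding (vertex u) (vertex v) (vertex ℓ)

    face-arrive : ∀ {u} v → IsLeaf v → Face u v v
    face-arrive v h = arrive (leaf-vertex {v} h)

    face-turn : ∀ {u} v {w ℓ} → ¬ IsLeaf v → turnAt v u ≡ w → Face v w ℓ → Face u v ℓ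
    face-turn {u} v {ℓ = ℓ} ¬leaf refl f = turn
      (λ h → ¬leaf (subst IsLeaf (label-vertex v) (leaf⇒ (vertex v) h)))
      (subst (λ w → ReachesLeaf embedding (vertex v) w (vertex ℓ))
        (cong vertex (cong₂ turnAt (sym (label-vertex v)) (sym (label-vertex u)))) f)

    -- Closes the leaf cycle: the walk returns along the spine to z without meeting a leaf, since
    -- the rotation takes a₃ to the parent around a₂, and the next a₂ to the own a₂ around a₃.
    face-top : ∀ i → Face (a₃ i) (a₂ i) xᵥ
    face-top = <-weakInduction (λ i → Face (a₃ i) (a₂ i) xᵥ)
      (face-turn (a₂ zero) (λ ()) (turn-a₂-a₃ zero) (face-turn zᵥ (λ ()) refl (face-arrive xᵥ refl)))
      (λ j f → face-turn (a₂ (suc j)) (λ ()) (turn-a₂-a₃ (suc j)) (face-turn (a₃ (inject₁ j)) (λ ()) (turn-a₃-next j) f))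

    face : ∀ v → IsLeaf v → Face v (firstNeighbour v) (nextLeaf v)
    face xᵥ     _ = face-turn zᵥ (λ ()) refl (face-arrive yᵥ refl)
    face yᵥ     _ = face-turn zᵥ (λ ()) refl (face-turn (a₂ zero) (λ ()) (turn-a₂-prev zero) (face-arrive (a₁ zero) refl))
    face zᵥ     ()
    face (a₁ i) _ = face-turn (a₂ i) (λ ()) refl (face-turn (a₃ i) (λ ()) (turn-a₃-a₂ i) (face-arrive (a₄ i) refl))
    face (a₄ i) _ = face-turn (a₃ i) (λ ()) refl (face-arrive (a₅ i) refl)
    face (a₅ i) _ = face-turn (a₃ i) (λ ()) refl (face-arrive (a₆ i) refl)
    face (a₆ i) _ = last (view i)
      where
      last : View i → Face (a₆ i) (a₃ i) (nextBottom i)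
      last ‵fromℕ rewrite nextBottom-fromℕ {k} = face-turn (a₃ (fromℕ k)) (λ ()) afterA₆-fromℕ (face-top (fromℕ k))
      last (‵inject₁ j) rewrite nextBottom-inject₁ j = face-turn (a₃ (inject₁ j)) (λ ()) (afterA₆-inject₁ j)
        (face-turn (a₂ (suc j)) (λ ()) (turn-a₂-prev (suc j)) (face-arrive (a₁ (suc j)) refl))

    -- A leaf has a single neighbour, so the first step of the walk is forced; determinism then
    -- identifies its end with that of `face`.
    nextLeaf⇒follows : ∀ u v → NextLeaf embedding u v → Follows (label u) (label v)
    nextLeaf⇒follows u v (leaf , p , a , r) = isLeaf , trans (sym (label-vertex _)) (cong label (reachesLeaf-unique embedding r′ r))
      where
      isLeaf : IsLeaf (label u)
      isLeaf = leaf⇒ u leaf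
      only : ∀ {L : List V} {q h} → L ≡ [] → q ∈ˡ h ∷ L → q ≡ h
      only refl (here e) = e
      p≡ : vertex (firstNeighbour (label u)) ≡ p
      p≡ = trans (cong vertex (sym (only isLeaf (joined⇒∈ (tree⇒joined u p a))))) (vertex-label p)
      r′ : ReachesLeaf embedding u p (vertex (nextLeaf (label u)))
      r′ = subst₂ (λ u p → ReachesLeaf embedding u p (vertex (nextLeaf (label u)))) refl p≡
        (subst (λ w → ReachesLeaf embedding w (vertex (firstNeighbour (label u))) (vertex (nextLeaf (label u)))) (vertex-label u)
          (face (label u) isLeaf))

    follows⇒nextLeaf : ∀ u v → Follows (label u) (label v) → NextLeaf embedding u v
    follows⇒nextLeaf u v (isLeaf , e) = leaf⇐ u isLeaf , vertex (firstNeighbour (label u)) ,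
      joined⇒tree u _ (subst (Joined (label u)) (sym (label-vertex _)) (∈⇒joined (label u) (here refl))) ,
      subst₂ (λ w ℓ → ReachesLeaf embedding w (vertex (firstNeighbour (label u))) ℓ) (vertex-label u)
        (trans (cong vertex e) (vertex-label v)) (face (label u) isLeaf)

    halin : IsHalin (G (suc k))
    halin = record
      { tree      = tree
      ; isTree    = T.isTree
      ; noDegree2 = λ u h → length≢2 (label u) (trans (sym (tree-degree u)) h)
      ; leaves≥3  = length≤card {L = vertex {k} xᵥ ∷ vertex {k} yᵥ ∷ vertex {k} (a₁ zero) ∷ []} {leaves tree}
          (Unique.map⁺ vertex-injective {xᵥ ∷ yᵥ ∷ a₁ zero ∷ []} (((λ ()) ∷ (λ ()) ∷ []) ∷ ((λ ()) ∷ []) ∷ [] ∷ []))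
          (leaf∈ {xᵥ} refl ∷ leaf∈ {yᵥ} refl ∷ leaf∈ {a₁ zero} refl ∷ [])
      ; embedding = embedding
      ; adjacency = λ u v → mk⇔ (to u v ∘ adj⇒ u v) (adj⇐ u v ∘ from u v)
      }
      where
      leaf∈ : ∀ {v} → IsLeaf v → vertex v ∈ leaves tree
      leaf∈ {v} h = lookup⇒[]= (vertex v) (leaves tree) (trans (lookup∘tabulate (λ u → does (degree tree u ℕ.≟ 1)) (vertex v))
        (dec-true (degree tree (vertex v) ℕ.≟ 1) (leaf-vertex {v} h)))
      to : ∀ u v → Adjacent (label u) (label v) → Adj tree u v ⊎ NextLeaf embedding u v ⊎ NextLeaf embedding v u
      to u v (inj₁ e) = [ inj₁ ∘ joined⇒tree u v , inj₂ ∘ inj₁ ∘ follows⇒nextLeaf u v ]′ (edge⇒ e)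
      to u v (inj₂ e) = [ inj₁ ∘ swap ∘ joined⇒tree v u , inj₂ ∘ inj₂ ∘ follows⇒nextLeaf v u ]′ (edge⇒ e)
      from : ∀ u v → Adj tree u v ⊎ NextLeaf embedding u v ⊎ NextLeaf embedding v u → Adjacent (label u) (label v)
      from u v (inj₁ a)        = [ up⇒ , swap ∘ up⇒ ]′ (tree⇒joined u v a)
      from u v (inj₂ (inj₁ f)) = follows⇒ (nextLeaf⇒follows u v f)
      from u v (inj₂ (inj₂ f)) = swap (follows⇒ (nextLeaf⇒follows v u f))

-- From natural-number bounds to rational ratios.

module Fractions where

  open Chains using (≤-by-difference)
  open Counting
  open import Data.Nat using (_+_; _*_; _≤_)
  open import Data.Rational using (ℚ; 0ℚ; 1ℚ; mkℚ; _/_; ↧ₙ_; toℚᵘ) renaming (_+_ to _+ℚ_; _*_ to _*ℚ_; _≤_ to _≤ℚ_; _<_ to _<ℚ_)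

  -- `_/_` reduces to lowest terms; passing to unnormalised fractions turns comparisons and sums
  -- into cross-multiplication.
  toℚᵘ-/ : ∀ n d → toℚᵘ (+ n / suc d) ≃ mkℚᵘ (+ n) d
  toℚᵘ-/ n d = ℚ.toℚᵘ-fromℚᵘ (mkℚᵘ (+ n) d)

  /-≤ : ∀ a c b d → a * suc d ≤ b * suc c → + a / suc c ≤ℚ + b / suc d
  /-≤ a c b d h = ℚ.toℚᵘ-cancel-≤
    (ℚᵘ.≤-respˡ-≃ (ℚᵘ.≃-sym (toℚᵘ-/ a c)) (ℚᵘ.≤-respʳ-≃ (ℚᵘ.≃-sym (toℚᵘ-/ b d))
      (*≤* (subst₂ ℤ._≤_ (ℤ.pos-* a (suc d)) (ℤ.pos-* b (suc c)) (ℤ.+≤+ h)))))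

  /-+ : ∀ a c b d → + a / suc c +ℚ + b / suc d ≡ + (a * suc d + b * suc c) / (suc c * suc d)
  /-+ a c b d = ℚ.toℚᵘ-injective (begin
    toℚᵘ (+ a / suc c +ℚ + b / suc d)             ≈⟨ ℚ.toℚᵘ-homo-+ (+ a / suc c) (+ b / suc d) ⟩
    toℚᵘ (+ a / suc c) ℚᵘ.+ toℚᵘ (+ b / suc d)    ≈⟨ ℚᵘ.+-cong (toℚᵘ-/ a c) (toℚᵘ-/ b d) ⟩
    mkℚᵘ (+ a) c ℚᵘ.+ mkℚᵘ (+ b) d                ≡⟨ cong (λ n → mkℚᵘ n (d + c * suc d)) numerator ⟨
    mkℚᵘ (+ (a * suc d + b * suc c)) (d + c * suc d)  ≈⟨ toℚᵘ-/ (a * suc d + b * suc c) (d + c * suc d) ⟨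
    toℚᵘ (+ (a * suc d + b * suc c) / (suc c * suc d)) ∎)
    where
    open ℚᵘ.≃-Reasoning
    numerator : + (a * suc d + b * suc c) ≡ + a ℤ.* + suc d ℤ.+ + b ℤ.* + suc c
    numerator = cong₂ ℤ._+_ (ℤ.pos-* a (suc d)) (ℤ.pos-* b (suc c))

  /-* : ∀ a c b d → (+ a / suc c) *ℚ (+ b / suc d) ≡ + (a * b) / (suc c * suc d)
  /-* a c b d = ℚ.toℚᵘ-injective (begin
    toℚᵘ ((+ a / suc c) *ℚ (+ b / suc d))         ≈⟨ ℚ.toℚᵘ-homo-* (+ a / suc c) (+ b / suc d) ⟩
    toℚᵘ (+ a / suc c) ℚᵘ.* toℚᵘ (+ b / suc d)    ≈⟨ ℚᵘ.*-cong (toℚᵘ-/ a c) (toℚᵘ-/ b d) ⟩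
    mkℚᵘ (+ a) c ℚᵘ.* mkℚᵘ (+ b) d                ≡⟨ cong (λ n → mkℚᵘ n (d + c * suc d)) (ℤ.pos-* a b) ⟨
    mkℚᵘ (+ (a * b)) (d + c * suc d)              ≈⟨ toℚᵘ-/ (a * b) (d + c * suc d) ⟨
    toℚᵘ (+ (a * b) / (suc c * suc d)) ∎)
    where open ℚᵘ.≃-Reasoning

  evc-bound : ∀ k → (+ 7 / 2) *ℚ (+ suc k / 1) +ℚ 1ℚ ≤ℚ + evc (G (suc k)) / 1
  evc-bound k = subst (_≤ℚ + evc (G (suc k)) / 1)
    (sym (trans (cong (_+ℚ 1ℚ) (/-* 7 1 (suc k) 0)) (/-+ (7 * suc k) 1 1 0)))
    (/-≤ (7 * suc k * 1 + 2) 1 (evc (G (suc k))) 0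
      (subst₂ _≤_ (lhs (suc k)) (ℕ.*-comm 2 (evc (G (suc k)))) (evc-lower k)))
    where
    lhs : ∀ r → 7 * r + 2 ≡ (7 * r * 1 + 2) * 1
    lhs = solve-∀

  1/↧≤ : ∀ δ → 0ℚ <ℚ δ → + 1 / ↧ₙ δ ≤ℚ δ
  1/↧≤ δ@(mkℚ (+ zero) d _) 0<δ with () ← ℤ.drop‿+<+ (ℚ.drop-*<* 0<δ)
  1/↧≤ δ@(mkℚ (+ suc n) d _) 0<δ = subst (+ 1 / suc d ≤ℚ_) (ℚ.↥p/↧p≡p δ)
    (/-≤ 1 d (suc n) d (ℕ.*-monoˡ-≤ (suc d) (s≤s (z≤n {n}))))
  1/↧≤ δ@(mkℚ (ℤ.-[1+ n ]) d _) 0<δ with () ← ℚ.drop-*<* 0<δ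

  -- The two bounds give a ratio of at least 7/6 - 4/(9r + 6), and 4/(9r + 6) is below 1/r, hence
  -- below δ once r is at least the denominator of δ.
  near-7/6 : ∀ r e m .{{_ : NonZero m}} δ → 0ℚ <ℚ δ → ↧ₙ δ ≤ r → 7 * r + 2 ≤ 2 * e → m ≤ 3 * r + 2 →
             + 7 / 6 ≤ℚ + e / m +ℚ δ
  near-7/6 r e (suc m) δ@(mkℚ _ d _) 0<δ D≤r he hm =
    ℚ.≤-trans (subst (+ 7 / 6 ≤ℚ_) (sym (/-+ e m 1 d)) (/-≤ 7 5 (e * suc d + 1 * suc m) (d + m * suc d) bound))
              (ℚ.+-monoʳ-≤ (+ e / suc m) (1/↧≤ δ 0<δ))
    where
    s : ℕ
    s = r ℕ.∸ suc d
    bound : 7 * (suc m * suc d) ≤ (e * suc d + 1 * suc m) * 6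
    -- With D = d + 1 and r = D + s, moving 6m to the left leaves m(7D - 6), whence the factor 7d +
    -- 1. The slack is 18r - 8D + 12 = 22 + 10d + 18s.
    bound = ≤-by-difference (22 + 10 * d + 18 * s)
      (ℕ.+-mono-≤ (ℕ.*-monoˡ-≤ (7 * d + 1) hm) (ℕ.*-monoʳ-≤ (3 * suc d) he))
      (subst (λ r → 7 * (suc m * suc d) + ((3 * r + 2) * (7 * d + 1) + 3 * suc d * (2 * e)) + (22 + 10 * d + 18 * s) ≡
                    (e * suc d + 1 * suc m) * 6 + (suc m * (7 * d + 1) + 3 * suc d * (7 * r + 2)))
             (ℕ.m+[n∸m]≡n D≤r) (identity m d e s))
      where
      identity : ∀ m d e s →
        7 * ((1 + m) * (1 + d)) + ((3 * ((1 + d) + s) + 2) * (7 * d + 1) + 3 * (1 + d) * (2 * e)) + (22 + 10 * d + 18 * s) ≡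
        (e * (1 + d) + 1 * (1 + m)) * 6 + ((1 + m) * (7 * d + 1) + 3 * (1 + d) * (7 * ((1 + d) + s) + 2))
      identity = solve-∀

  ratio-bound : ∀ k δ → 0ℚ <ℚ δ → ↧ₙ δ ≤ suc k → + 7 / 6 ≤ℚ ratio (G (suc k)) {{mvc-nonZero k}} +ℚ δ
  ratio-bound k δ 0<δ D≤r =
    near-7/6 (suc k) (evc (G (suc k))) (mvc (G (suc k))) {{mvc-nonZero k}} δ 0<δ D≤r (evc-lower k) (mvc-upper k)

-- The ratio bounds and the supremum.

open Counting using (mvc-nonZero)
open HalinEmbedding using (halin)
open Fractions
open import Data.Rational using (_+_; _*_; _≤_; _/_; 1ℚ; 0ℚ; ↧ₙ_; _-_; -_; _<_)

ratio-near : ∀ k q δ → 0ℚ < δ → ↧ₙ δ ℕ.≤ suc k → q + δ < + 7 / 6 → q < ratio (G (suc k)) {{mvc-nonZero k}}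
ratio-near k q δ 0<δ D≤r h = ℚ.≰⇒> λ r≤q →
  ℚ.<-irrefl refl (ℚ.≤-<-trans (ℚ.≤-trans (ratio-bound k δ 0<δ D≤r) (ℚ.+-monoˡ-≤ δ r≤q)) h)

+-minus : ∀ p q → p + (q - p) ≡ q
+-minus p q = trans (sym (ℚ.+-assoc p q (- p))) (AbelianGroupProperties.xyx⁻¹≈y ℚ.+-0-abelianGroup p q)

below-gap : ∀ {p q δ} → δ < p - q → q + δ < p
below-gap {p} {q} {δ} h = subst (q + δ <_) (+-minus q p) (ℚ.+-monoʳ-< q h)

L-below-U : ∀ (x : ℝ) {p q} → L x p → U x q → p < q
L-below-U x {p} {q} l u with ℚ.<-cmp p q
... | tri< p<q _ _ = p<q
... | tri≈ _ refl _ = ⊥-elim (ℝ.disjoint x p (l , u))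
... | tri> _ _ q<p = ⊥-elim (ℝ.disjoint x q (Equivalence.from (ℝ.L-rounded x q) (p , q<p , l) , u))

G-nonisomorphic : ∀ i j → i ≢ j → ¬ (G (suc i) ≅ G (suc j))
G-nonisomorphic i j i≢j iso = i≢j (ℕ.suc-injective (ℕ.*-cancelʳ-≡ (suc i) (suc j) 6
  (ℕ.+-cancelˡ-≡ 3 (suc i ℕ.* 6) (suc j ℕ.* 6) (Permutation.↔⇒≡ (_≅_.vertices iso)))))

ratio-within : (ε : ℝ) → Positive ε → ∃[ r ] Σ[ nz ∈ NonZero r ] RatioAtLeast ((+ 7 / 6) ⊖ ε) (G r {{nz}})
ratio-within ε pos with Equivalence.to (ℝ.L-rounded ε 0ℚ) pos
-- Roundedness of the lower cut at 0 supplies a positive rational δ below ε, and its denominator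
-- serves as r.
... | δ , 0<δ , Lδ = ↧ₙ δ , _ , mvc-nonZero _ ,
  λ q u → ratio-near _ q δ 0<δ ℕ.≤-refl (below-gap {+ 7 / 6} {q} (L-below-U ε Lδ u))

7/6≤ρ : (+ 7 / 6) ≤ᶜ ρ IsHalin
7/6≤ρ q q<7/6 with ℚ.<-dense q<7/6
-- A value strictly between q and 7/6 leaves room on both sides: q is in the lower cut of the
-- witness, and the positive gap to 7/6 is a tolerance met by every r beyond its denominator.
... | m , q<m , m<7/6 = fromℚ m , (graph , nonisomorphic , λ i → halin , mvc-nonZero _ , bound i) , q<m
  where
  δ = + 7 / 6 - m
  0<δ : 0ℚ < δ
  0<δ = subst (_< δ) (ℚ.+-inverseʳ m) (ℚ.+-monoˡ-< (- m) m<7/6)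
  graph : ℕ → ∃[ n ] Graph n
  graph i = _ , G (suc (i ℕ.+ ↧ₙ δ))
  nonisomorphic : ∀ i j → i ≢ j → ¬ (proj₂ (graph i) ≅ proj₂ (graph j))
  nonisomorphic i j i≢j = G-nonisomorphic _ _ λ e → i≢j (ℕ.+-cancelʳ-≡ (↧ₙ δ) i j e)
  bound : ∀ i p → p < m → p < ratio (proj₂ (graph i)) {{mvc-nonZero _}}
  bound i p p<m = ratio-near _ p δ 0<δ (ℕ.m≤n⇒m≤1+n (ℕ.m≤n+m (↧ₙ δ) i))
    (subst (p + δ <_) (+-minus m (+ 7 / 6)) (ℚ.+-monoˡ-< δ p<m))

theorem7 : ((r : ℕ) .{{_ : NonZero r}} →
    IsHalin (G r) × ((+ 7 / 2) * (+ r / 1) + 1ℚ ≤ + evc (G r) / 1)) ×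
    ((ε : ℝ) → Positive ε →
    ∃[ r ] Σ[ nz ∈ NonZero r ] RatioAtLeast ((+ 7 / 6) ⊖ ε) (G r {{nz}})) ×
    ((+ 7 / 6) ≤ᶜ ρ IsHalin)
theorem7 = (λ { (suc k) → halin , evc-bound k }) , ratio-within , 7/6≤ρ
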